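{- There is an algorithm that computes an optimal routing for the Vehicle Routing Problem (VRP) in $|C|^{O(|C|)}\cdot n^{O(1)}$ steps, where $C$ is the set of clients and $n=|V(G)|$ is the number of vertices of the input graph.
   Context: All graphs are finite and undirected, and $\mathbb N = \{0,1,2,\dots\}$. A walk in $G$ is a sequence of vertices $(v_1,\dots,v_m)$ with consecutive vertices adjacent; vertices and edges may be repeated. It is closed if $v_1 = v_m$. For edge weights $w\colon E(G)\to\mathbb N$, the weight of a walk is $w(p)=\sum_{i=1}^{m-1} w(v_i,v_{i+1})$. VRP: The input consists of a graph $G$ with edge weights $w\colon E(G)\to\mathbb N$, a nonempty set of depots $D\subseteq V(G)$, a set of clients $C\subseteq V(G)$, and a number of vehicles $k\in\mathbb N$. A routing is a set of $k'$ walks $R=\{p_1,\dots,p_{k'}\}$ (one walk per vehicle) together with an assignment $A\colon C\to[k']$ such that $k'\le k$, every walk starts at a vertex of $D$, every client $c\in C$ is a vertex of $p_{A(c)}$, and every walk in $R$ is closed. Its weight is $w(R)=\sum_{p\in R}w(p)$; a routing of minimum weight is called optimal. -}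

module Defs where

open import Data.Bool.Base using (Bool; true; false; T; if_then_else_)
open import Data.Fin.Base using (Fin; toℕ)
open import Data.Fin.Subset using (Subset; Nonempty; _∈_)
open import Data.List.Base using (List; []; _∷_; length; lookup; map; sum; tabulate; concat)
import Data.List.Membership.Propositional as List
open import Data.Nat.Base using (ℕ; zero; suc; _+_; _∸_; _≤_; _≡ᵇ_)
open import Data.Product.Base using (Σ-syntax; ∃-syntax; _×_)
open import Data.Sum.Base using (_⊎_)
open import Data.Unit.Base using (tt)
import Data.Vec.Base as Vec
open import Relation.Binary.Construct.Closure.ReflexiveTransitive using (Star; ε; _◅_)
open import Relation.Binary.PropositionalEquality.Core using (_≡_; _≢_)
open import Relation.Nullary.Negation.Core using (¬_)

------------------------------------------------------------------------
-- Graphs and walks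

-- Parallel edges are excluded because an edge is determined by its end
-- points; loops are not excluded.
record Graph : Set where
  field
    n       : ℕ
    adj     : Fin n → Fin n → Bool
    adj-sym : ∀ u v → adj u v ≡ adj v u

  V : Set
  V = Fin n

  Adj : V → V → Set
  Adj u v = T (adj u v)

  Walk : V → V → Set
  Walk = Star Adj

  -- The sequence (v₁ , … , vₘ); it is never empty.
  vertices : ∀ {u v} → Walk u v → List V
  vertices {u} ε       = u ∷ []
  vertices {u} (_ ◅ p) = u ∷ vertices p

-- Functions E(G) → ℕ; T b has at most one element, so an edge has a single
-- weight in each orientation, and w-sym identifies the two orientations.
record EdgeWeights (G : Graph) : Set where
  open Graph G
  field
    w     : ∀ u v → Adj u v → ℕ
    w-sym : ∀ u v (e : Adj u v) (e′ : Adj v u) → w u v e ≡ w v u e′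

  walkWeight : ∀ {u v} → Walk u v → ℕ
  walkWeight ε                   = 0
  walkWeight (_◅_ {u} {v} e p) = w u v e + walkWeight p

------------------------------------------------------------------------
-- The Vehicle Routing Problem

record Instance : Set where
  field
    graph           : Graph
    weights         : EdgeWeights graph
  open Graph graph public
  open EdgeWeights weights public
  field
    depots          : Subset n
    depots-nonempty : Nonempty depots
    clients         : Subset n
    k               : ℕ

record Routing (I : Instance) : Set where
  open Instance I
  field
    k′       : ℕ
    k′≤k     : k′ ≤ k
    start    : Fin k′ → V
    start∈D  : ∀ i → start i ∈ depots
    -- Closed walks: both end points are start i.
    walk     : ∀ i → Walk (start i) (start i)
    assign   : ∀ c → c ∈ clients → Fin k′
    visits   : ∀ c (c∈C : c ∈ clients) → c List.∈ vertices (walk (assign c c∈C))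

  weight : ℕ
  weight = sum (tabulate (λ i → walkWeight (walk i)))

Optimal : ∀ {I} → Routing I → Set
Optimal {I} R = ∀ (R′ : Routing I) → Routing.weight R ≤ Routing.weight R′

------------------------------------------------------------------------
-- Unit-cost random access machine, with structured control flow
--
-- The memory consists of scalar registers and arrays, all indexed by ℕ
-- and holding natural numbers.  Register and array names are constants of
-- the program; positions within an array can be computed.  Addition, truncated
-- subtraction and memory accesses take one step whatever the size of the
-- operands: the time bound is not allowed to depend on the edge
-- weights or on k.  Multiplication is not a basic operation, because
-- unit-cost multiplication of unbounded integers would not be a
-- realistic measure of time.

data Exp : Set where
  lit  : ℕ → Exp
  reg  : ℕ → Exp
  _⊕_  : Exp → Exp → Exp
  _⊖_  : Exp → Exp → Exp
  load : ℕ → Exp → Exp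

data Cmd : Set where
  skip   : Cmd
  _≔_    : ℕ → Exp → Cmd
  store  : ℕ → Exp → Exp → Cmd
  _⨾_    : Cmd → Cmd → Cmd
  cond   : Exp → Cmd → Cmd → Cmd
  while  : Exp → Cmd → Cmd

infixl 6 _⊕_ _⊖_
infix  4 _≔_
infixr 3 _⨾_

record State : Set where
  constructor ⟪_,_⟫
  field
    regs   : ℕ → ℕ
    arrays : ℕ → ℕ → ℕ

open State public

_[_↦_] : ∀ {A : Set} → (ℕ → A) → ℕ → A → (ℕ → A)
(f [ i ↦ x ]) j = if i ≡ᵇ j then x else f j

eval : Exp → State → ℕ
eval (lit m)    σ = m
eval (reg x)    σ = regs σ x
eval (e₁ ⊕ e₂)  σ = eval e₁ σ + eval e₂ σ
eval (e₁ ⊖ e₂)  σ = eval e₁ σ ∸ eval e₂ σ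
eval (load a e) σ = arrays σ a (eval e σ)

cost : Exp → ℕ
cost (lit _)    = 1
cost (reg _)    = 1
cost (e₁ ⊕ e₂)  = suc (cost e₁ + cost e₂)
cost (e₁ ⊖ e₂)  = suc (cost e₁ + cost e₂)
cost (load _ e) = suc (cost e)

setReg : ℕ → ℕ → State → State
setReg x m σ = ⟪ regs σ [ x ↦ m ] , arrays σ ⟫

setCell : ℕ → ℕ → ℕ → State → State
setCell a i m σ = ⟪ regs σ , arrays σ [ a ↦ arrays σ a [ i ↦ m ] ] ⟫

-- c , σ ⇓ σ′ ⟨ t ⟩: started in σ, the command c halts in σ′ after exactly
-- t steps.  A test succeeds when its value is nonzero.
infix 2 _,_⇓_⟨_⟩

data _,_⇓_⟨_⟩ : Cmd → State → State → ℕ → Set where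

  ⇓skip  : ∀ {σ} → skip , σ ⇓ σ ⟨ 1 ⟩

  ⇓≔     : ∀ {x e σ} →
           (x ≔ e) , σ ⇓ setReg x (eval e σ) σ ⟨ suc (cost e) ⟩

  ⇓store : ∀ {a e₁ e₂ σ} →
           store a e₁ e₂ , σ ⇓ setCell a (eval e₁ σ) (eval e₂ σ) σ
             ⟨ suc (cost e₁ + cost e₂) ⟩

  ⇓⨾     : ∀ {c₁ c₂ σ σ′ σ″ t₁ t₂} →
           c₁ , σ ⇓ σ′ ⟨ t₁ ⟩ → c₂ , σ′ ⇓ σ″ ⟨ t₂ ⟩ →
           (c₁ ⨾ c₂) , σ ⇓ σ″ ⟨ t₁ + t₂ ⟩

  ⇓then  : ∀ {e c₁ c₂ σ σ′ t} → eval e σ ≢ 0 →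
           c₁ , σ ⇓ σ′ ⟨ t ⟩ →
           cond e c₁ c₂ , σ ⇓ σ′ ⟨ suc (cost e + t) ⟩

  ⇓else  : ∀ {e c₁ c₂ σ σ′ t} → eval e σ ≡ 0 →
           c₂ , σ ⇓ σ′ ⟨ t ⟩ →
           cond e c₁ c₂ , σ ⇓ σ′ ⟨ suc (cost e + t) ⟩

  ⇓stop  : ∀ {e c σ} → eval e σ ≡ 0 →
           while e c , σ ⇓ σ ⟨ suc (cost e) ⟩

  ⇓loop  : ∀ {e c σ σ′ σ″ t₁ t₂} → eval e σ ≢ 0 →
           c , σ ⇓ σ′ ⟨ t₁ ⟩ → while e c , σ′ ⇓ σ″ ⟨ t₂ ⟩ →
           while e c , σ ⇓ σ″ ⟨ suc (cost e + t₁ + t₂) ⟩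

------------------------------------------------------------------------
-- Input and output of a VRP program

fromList : List ℕ → ℕ → ℕ
fromList []       _       = 0
fromList (x ∷ xs) zero    = x
fromList (x ∷ xs) (suc i) = fromList xs i

characteristic : ∀ {n} → Subset n → List ℕ
characteristic p = map (λ b → if b then 1 else 0) (Vec.toList p)

-- A matrix entry is 0 for a non-edge and suc m for an edge of weight m.
entry : (b : Bool) → (T b → ℕ) → ℕ
entry false _ = 0
entry true  f = suc (f tt)

module _ (I : Instance) where
  open Instance I

  -- The adjacency matrix in row-major order: (u , v) is at n * u + v.
  matrix : List ℕ
  matrix = concat (tabulate λ u → tabulate λ v → entry (adj u v) (w u v))

  -- Registers 0 and 1 hold n and k; arrays 0, 1 and 2 hold the
  -- depots, the clients and the weighted adjacency matrix; all
  -- remaining memory is 0.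
  initial : State
  initial = ⟪ fromList (n ∷ k ∷ []) , input ⟫
    where
    input : ℕ → ℕ → ℕ
    input 0 = fromList (characteristic depots)
    input 1 = fromList (characteristic clients)
    input 2 = fromList matrix
    input _ = λ _ → 0

module _ {I : Instance} (R : Routing I) where
  open Instance I
  open Routing R

  -- Each walk is written as its number of vertices followed by its vertices.
  walkList : List ℕ
  walkList = concat (tabulate λ i →
    let vs = vertices (walk i) in length vs ∷ map toℕ vs)

  -- Register 1 holds k′, array 0 starts with the walks, and array 1 holds the
  -- assignment, indexed by the clients.
  record Describes (σ : State) : Set where
    field
      k′-in-reg       : regs σ 1 ≡ k′
      walks-in-array  : ∀ i → arrays σ 0 (toℕ i) ≡ lookup walkList i
      assign-in-array : ∀ c (c∈C : c ∈ clients) →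
                        arrays σ 1 (toℕ c) ≡ toℕ (assign c c∈C)

-- An instance may have no routing at all (for example, when a client cannot be
-- reached from any depot); register 0 reports whether there is one.
IsAnswer : Instance → State → Set
IsAnswer I σ =
    (regs σ 0 ≡ 1 × (Σ[ R ∈ Routing I ] (Optimal R × Describes R σ)))
  ⊎ (regs σ 0 ≡ 0 × ¬ Routing I)

SolvesVRPWithin : Cmd → (Instance → ℕ) → Set
SolvesVRPWithin P bound = ∀ I →
  ∃[ σ ] ∃[ t ] (P , initial I ⇓ σ ⟨ t ⟩) × t ≤ bound I × IsAnswer I σ

{-# OPTIONS --safe #-}
module Submission where

open import Data.Bool.Base using (Bool; true; false; T; not; _∧_; if_then_else_)
open import Data.Bool.Properties using (T-∧)
open import Data.Fin.Base using (Fin; zero; suc; toℕ; fromℕ<; punchIn; punchOut)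
open import Data.Fin.Properties
  using (toℕ<n; toℕ-injective; toℕ-fromℕ<; fromℕ<-injective; injective⇒≤; any?; ¬∀⟶∃¬; punchIn-punchOut)
import Data.Fin.Properties as Fin
open import Data.Fin.Subset using (Subset; _∈_; ∣_∣)
open import Data.Fin.Subset.Properties using (_∈?_)
open import Data.List.Base using (List; []; _∷_; [_]; length; lookup; map; tabulate; concat; _++_)
open import Data.List.Membership.DecPropositional using () renaming (_∈?_ to member?)
import Data.List.Membership.Propositional as List
open import Data.List.Membership.Propositional.Properties using (∈-lookup; ∈-++⁺ˡ)
open import Data.List.Properties
  using (length-map; length-++; length-tabulate; map-++; map-tabulate; tabulate-lookup; concat-++; ++-identityʳ)
open import Data.List.Relation.Unary.All as All using (All; []; _∷_)
open import Data.List.Relation.Unary.All.Properties using (¬Any⇒All¬)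
open import Data.List.Relation.Unary.AllPairs using ([]; _∷_)
open import Data.List.Relation.Unary.Any using (Any; here; there)
open import Data.List.Relation.Unary.Any.Properties using (tabulate⁺)
open import Data.List.Relation.Unary.Unique.Propositional using (Unique)
open import Data.Nat.Base
open import Data.Nat.DivMod
open import Data.Nat.Divisibility using (n∣m*n)
open import Data.Nat.ListAction using (sum)
open import Data.Nat.ListAction.Properties using (sum-++)
open import Data.Nat.Properties
open import Data.Nat.Tactic.RingSolver using (solve-∀)
open import Data.Product.Base using (Σ-syntax; ∃-syntax; _×_; _,_; proj₁; proj₂)
open import Data.Sum.Base using (_⊎_; inj₁; inj₂; [_,_]′)
open import Data.Unit.Base using (⊤; tt)
open import Data.Vec.Base using ([]; _∷_; here; there)
open import Function.Base using (_∘_)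
open import Function.Bundles using (Equivalence)
open import Relation.Binary.Construct.Closure.ReflexiveTransitive using (ε; _◅_; _◅◅_)
open import Relation.Binary.PropositionalEquality hiding ([_])
open import Relation.Nullary
open import Defs

-- A routing is traced by a path in a graph of states, each consisting of the
-- current vertex v, the depot d of the current vehicle, the number j of
-- vehicles opened so far and the set of visited clients.  A step either stays,
-- moves along an edge, or, when v = d, opens the next vehicle at any depot; it
-- may add the vertex it leaves to the visited set.  Vehicles without an assigned
-- client can be dropped, so j ≤ n suffices and there are N = 2^|C| (n + 1) n²
-- states, coded as mixed radix numbers.  A cheapest path from the state 0, in
-- which no vehicle is open, to a state with v = d and all clients visited needs
-- at most N steps, because cycles can be cut out.  It is found by dynamic
-- programming over the number of remaining steps; stored choices let the path be
-- followed forwards while the walks are written.  Every loop makes at most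
-- M = N + n + 3 rounds, so the time is polynomial in M, and 2^|C| ≤ 2 |C|^|C|.

-- Hoare logic with syntactic frame and time conditions

-- One convention serves edges, depots, transitions and table entries: 0 means impossible and
-- `suc m` means cost `m`. A depot bit is therefore already the price of opening a vehicle for free,
-- and adding two such numbers calls for subtracting 1. A vertex is marked on leaving it, while the
-- digits still name the vehicle standing there; so the assignment can be written in the same step,
-- and the last vertex of a walk needs one extra stay. Free stays also turn "at most N steps" into
-- "exactly N", so only the last layer of the table is inspected. Optimality is a comparison from
-- two sides: every routing yields a path of no greater weight, and the traced path yields a routing
-- whose weight is exactly the table value. The machine neither multiplies nor divides, so radices
-- are multiplied by repeated addition and states decoded by repeated subtraction. Both stay within
-- M rounds: a state is at most N, and a radix is at most n + 3. Running time is a function of the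
-- syntax and M, so the correctness proofs only have to bound the rounds of each loop.

keepsReg : ℕ → Cmd → Bool
keepsReg x skip          = true
keepsReg x (y ≔ _)       = not (y ≡ᵇ x)
keepsReg x (store _ _ _) = true
keepsReg x (c ⨾ d)       = keepsReg x c ∧ keepsReg x d
keepsReg x (cond _ c d)  = keepsReg x c ∧ keepsReg x d
keepsReg x (while _ c)   = keepsReg x c

keepsArray : ℕ → Cmd → Bool
keepsArray a skip          = true
keepsArray a (_ ≔ _)       = true
keepsArray a (store b _ _) = not (b ≡ᵇ a)
keepsArray a (c ⨾ d)       = keepsArray a c ∧ keepsArray a d
keepsArray a (cond _ c d)  = keepsArray a c ∧ keepsArray a d
keepsArray a (while _ c)   = keepsArray a c

-- The side conditions depend on the command alone. For a concrete command they compute to the unit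
-- type, so users pass `_` and frame reasoning costs no proof.
record Keeps (c : Cmd) (σ σ′ : State) : Set where
  constructor keeping
  field
    reg=   : ∀ x → T (keepsReg x c) → regs σ′ x ≡ regs σ x
    array= : ∀ a → T (keepsArray a c) → arrays σ′ a ≡ arrays σ a

open Keeps

update-same : ∀ {A : Set} (f : ℕ → A) i {v} → (f [ i ↦ v ]) i ≡ v
update-same f zero    = refl
update-same f (suc i) = update-same (f ∘ suc) i

update-≢ᵇ : ∀ {A : Set} (f : ℕ → A) i {j v} → T (not (i ≡ᵇ j)) → (f [ i ↦ v ]) j ≡ f j
update-≢ᵇ f i {j} i≢j with i ≡ᵇ j
... | false = refl

T-∧ˡ : ∀ {x y} → T (x ∧ y) → T x
T-∧ˡ = proj₁ ∘ Equivalence.to T-∧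

T-∧ʳ : ∀ {x y} → T (x ∧ y) → T y
T-∧ʳ {x} = proj₂ ∘ Equivalence.to (T-∧ {x})

⇓-keepsReg : ∀ {c σ σ′ t} → c , σ ⇓ σ′ ⟨ t ⟩ → ∀ x → T (keepsReg x c) → regs σ′ x ≡ regs σ x
⇓-keepsReg ⇓skip x k = refl
⇓-keepsReg (⇓≔ {y} {σ = σ}) x k = update-≢ᵇ (regs σ) y k
⇓-keepsReg ⇓store x k = refl
⇓-keepsReg (⇓⨾ {c₁} p q) x k =
  trans (⇓-keepsReg q x (T-∧ʳ {keepsReg x c₁} k)) (⇓-keepsReg p x (T-∧ˡ k))
⇓-keepsReg (⇓then _ p) x k = ⇓-keepsReg p x (T-∧ˡ k)
⇓-keepsReg (⇓else {c₁ = c₁} _ p) x k = ⇓-keepsReg p x (T-∧ʳ {keepsReg x c₁} k)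
⇓-keepsReg (⇓stop _) x k = refl
⇓-keepsReg (⇓loop _ p q) x k = trans (⇓-keepsReg q x k) (⇓-keepsReg p x k)

⇓-keepsArray : ∀ {c σ σ′ t} → c , σ ⇓ σ′ ⟨ t ⟩ → ∀ a → T (keepsArray a c) → arrays σ′ a ≡ arrays σ a
⇓-keepsArray ⇓skip a k = refl
⇓-keepsArray ⇓≔ a k = refl
⇓-keepsArray (⇓store {b} {σ = σ}) a k = update-≢ᵇ (arrays σ) b k
⇓-keepsArray (⇓⨾ {c₁} p q) a k =
  trans (⇓-keepsArray q a (T-∧ʳ {keepsArray a c₁} k)) (⇓-keepsArray p a (T-∧ˡ k))
⇓-keepsArray (⇓then _ p) a k = ⇓-keepsArray p a (T-∧ˡ k)
⇓-keepsArray (⇓else {c₁ = c₁} _ p) a k = ⇓-keepsArray p a (T-∧ʳ {keepsArray a c₁} k)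
⇓-keepsArray (⇓stop _) a k = refl
⇓-keepsArray (⇓loop _ p q) a k = trans (⇓-keepsArray q a k) (⇓-keepsArray p a k)

⇓-keeps : ∀ {c σ σ′ t} → c , σ ⇓ σ′ ⟨ t ⟩ → Keeps c σ σ′
⇓-keeps p = keeping (⇓-keepsReg p) (⇓-keepsArray p)

keeps-trans : ∀ {c σ σ′ σ″} → Keeps c σ σ′ → Keeps c σ′ σ″ → Keeps c σ σ″
keeps-trans p q = keeping (λ x k → trans (reg= q x k) (reg= p x k))
                          (λ a k → trans (array= q a k) (array= p a k))

-- The time of a command in which no while loop makes more than M rounds
-- each time it is executed.
bound : ℕ → Cmd → ℕ
bound M skip            = 1
bound M (x ≔ e)         = suc (cost e)
bound M (store a e₁ e₂) = suc (cost e₁ + cost e₂)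
bound M (c ⨾ d)         = bound M c + bound M d
bound M (cond e c d)    = suc (cost e + (bound M c + bound M d))
bound M (while e c)     = suc (cost e) + M * (suc (cost e) + bound M c)

for : ℕ → ℕ → Cmd → Cmd
for x y c = (x ≔ lit 0) ⨾ while (reg y ⊖ reg x) (c ⨾ (x ≔ reg x ⊕ lit 1))

-- The functional counterpart of `cond`: a nonzero test selects the first value, zero the second.
if0 : ℕ → ℕ → ℕ → ℕ
if0 zero    a b = b
if0 (suc _) a b = a

if0-≡0 : ∀ {x a b} → x ≡ 0 → if0 x a b ≡ b
if0-≡0 refl = refl

if0-≢0 : ∀ {x a b} → x ≢ 0 → if0 x a b ≡ a
if0-≢0 {zero}  x≢0 = contradiction refl x≢0
if0-≢0 {suc x} x≢0 = refl

module Timed (M : ℕ) where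

  record Run (c : Cmd) (σ : State) (Q : State → Set) : Set where
    constructor run
    field
      {final}  : State
      {steps}  : ℕ
      executes : c , σ ⇓ final ⟨ steps ⟩
      in-time  : steps ≤ bound M c
      post     : Q final

  private variable
    c d : Cmd
    σ : State
    Q Q′ : State → Set
    e e₁ e₂ : Exp
    x y a : ℕ

  weaken : Run c σ Q → (∀ {σ′} → Keeps c σ σ′ → Q σ′ → Q′ σ′) → Run c σ Q′
  weaken (run p t q) f = run p t (f (⇓-keeps p) q)

  run-skip : Q σ → Run skip σ Q
  run-skip q = run ⇓skip ≤-refl q

  run-≔ : Q (setReg x (eval e σ) σ) → Run (x ≔ e) σ Q
  run-≔ q = run ⇓≔ ≤-refl q

  run-store : Q (setCell a (eval e₁ σ) (eval e₂ σ) σ) → Run (store a e₁ e₂) σ Q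
  run-store q = run ⇓store ≤-refl q

  run-⨾ : Run c σ (λ σ′ → Run d σ′ Q) → Run (c ⨾ d) σ Q
  run-⨾ (run p t (run p′ t′ q)) = run (⇓⨾ p p′) (+-mono-≤ t t′) q

  infixr 3 _then_
  _then_ : Run c σ Q → (∀ {σ′} → Keeps c σ σ′ → Q σ′ → Run d σ′ Q′) → Run (c ⨾ d) σ Q′
  p then f = run-⨾ (weaken p f)

  run-cond : (eval e σ ≢ 0 → Run c σ Q) → (eval e σ ≡ 0 → Run d σ Q) → Run (cond e c d) σ Q
  run-cond {e} {σ} {c} {Q} {d} yes′ no′ with eval e σ ≟ 0
  ... | no e≢0 = let run p t q = yes′ e≢0 in
    run (⇓then e≢0 p) (s≤s (+-monoʳ-≤ (cost e) (m≤n⇒m≤n+o _ t))) q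
  ... | yes e≡0 = let run p t q = no′ e≡0 in
    run (⇓else e≡0 p) (s≤s (+-monoʳ-≤ (cost e) (m≤n⇒m≤o+n _ t))) q

  run-cond-if0 : ∀ {m n} → Run c σ (λ σ′ → regs σ′ x ≡ m) → Run d σ (λ σ′ → regs σ′ x ≡ n) →
                 Run (cond e c d) σ (λ σ′ → regs σ′ x ≡ if0 (eval e σ) m n)
  run-cond-if0 {σ = σ} {e = e} p q = run-cond
    (λ e≢0 → weaken p λ _ h → trans h (sym (if0-≢0 e≢0)))
    (λ e≡0 → weaken q λ _ h → trans h (sym (if0-≡0 e≡0)))

  -- The first index of the invariant bounds the number of rounds left.
  run-while : ∀ {j} (I : ℕ → State → Set) →
              (∀ {j σ′} → Keeps (while e c) σ σ′ → I j σ′ → eval e σ′ ≢ 0 →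
                 ∃[ i ] j ≡ suc i × Run c σ′ (I i)) →
              j ≤ M → I j σ →
              Run (while e c) σ (λ σ′ → eval e σ′ ≡ 0 × ∃[ i ] I i σ′)
  run-while {e} {c} {σ} {j} I body j≤M base =
    let _ , _ , p , t , q = go j σ (keeping (λ _ _ → refl) (λ _ _ → refl)) base in
    run p (≤-trans t (+-monoʳ-≤ _ (*-monoˡ-≤ _ j≤M))) q
    where
    round = suc (cost e) + bound M c
    go : ∀ j σ′ → Keeps (while e c) σ σ′ → I j σ′ →
         ∃[ σ″ ] ∃[ t ] (while e c , σ′ ⇓ σ″ ⟨ t ⟩) × t ≤ suc (cost e) + j * round ×
           (eval e σ″ ≡ 0 × ∃[ i ] I i σ″)
    go j σ′ κ inv with eval e σ′ ≟ 0
    ... | yes e≡0 = σ′ , _ , ⇓stop e≡0 , m≤m+n _ _ , e≡0 , j , inv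
    ... | no e≢0 with body κ inv e≢0
    -- Matching `refl` turns `j` into `suc i`, which makes the recursion structural and also rules
    -- out another round when `j` is 0.
    ... | i , refl , run {σ₁} {t₁} p t inv₁ =
      let κ₁ = ⇓-keeps p
          σ₂ , t₂ , p₂ , t₂≤ , q = go i σ₁ (keeps-trans κ (keeping (reg= κ₁) (array= κ₁))) inv₁
      in σ₂ , _ , ⇓loop e≢0 p p₂ , time t t₂≤ , q
      where
      open ≤-Reasoning
      time : ∀ {t₁ t₂} → t₁ ≤ bound M c → t₂ ≤ suc (cost e) + i * round →
             suc (cost e + t₁ + t₂) ≤ suc (cost e) + suc i * round
      time {t₁} {t₂} p q = begin
        suc (cost e) + t₁ + t₂                        ≤⟨ +-mono-≤ (+-monoʳ-≤ _ p) q ⟩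
        round + (suc (cost e) + i * round)            ≡⟨ +-assoc round (suc (cost e)) _ ⟨
        round + suc (cost e) + i * round              ≡⟨ cong (_+ i * round) (+-comm round (suc (cost e))) ⟩
        suc (cost e) + round + i * round              ≡⟨ +-assoc (suc (cost e)) round _ ⟩
        suc (cost e) + suc i * round                  ∎

  -- The body has to restore the invariant for the state after the increment, so `I` may speak of
  -- all registers. Internally `i + j ≡ K` makes `j` the number of rounds left, as `run-while`
  -- demands.
  run-for : ∀ {K} (I : ℕ → State → Set) → K ≤ M → regs σ y ≡ K →
            {_ : T (not (x ≡ᵇ y))} {_ : T (keepsReg x c)} {_ : T (keepsReg y c)} →
            I 0 (setReg x 0 σ) →
            (∀ {i σ′} → Keeps (for x y c) σ σ′ → i < K → regs σ′ x ≡ i → I i σ′ →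
               Run c σ′ (λ σ″ → I (suc i) (setReg x (suc i) σ″))) →
            Run (for x y c) σ (I K)
  run-for {σ = σ} {y} {x} {c} {K} I K≤M y≡K {x≢y} {kx} {ky} base body =
    run-⨾ (run-≔ (weaken (run-while Inv step K≤M
        (0 , refl , update-same (regs σ) x , trans (update-≢ᵇ (regs σ) x x≢y) y≡K , base)) λ _ → done))
    where
    Inv : ℕ → State → Set
    Inv j σ′ = ∃[ i ] i + j ≡ K × regs σ′ x ≡ i × regs σ′ y ≡ K × I i σ′
    done : ∀ {σ′} → regs σ′ y ∸ regs σ′ x ≡ 0 × ∃[ j ] Inv j σ′ → I K σ′
    done {σ′} (z , j , i , refl , refl , y≡ , inv) = subst (λ n → I n σ′) i≡i+j inv
      where
      i≡i+j : regs σ′ x ≡ regs σ′ x + j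
      i≡i+j = ≤-antisym (m≤m+n _ j) (m∸n≡0⇒m≤n (subst (λ n → n ∸ regs σ′ x ≡ 0) y≡ z))
    step : ∀ {j σ′} → Keeps (while (reg y ⊖ reg x) (c ⨾ (x ≔ reg x ⊕ lit 1))) (setReg x 0 σ) σ′ →
           Inv j σ′ → regs σ′ y ∸ regs σ′ x ≢ 0 →
           ∃[ i ] j ≡ suc i × Run (c ⨾ (x ≔ reg x ⊕ lit 1)) σ′ (Inv i)
    step {zero} {σ′} κ (i , i+0≡K , x≡ , y≡ , inv) nz =
      contradiction (trans (cong₂ _∸_ (trans y≡ (trans (sym i+0≡K) (+-identityʳ i))) x≡) (n∸n≡0 i)) nz
    step {suc j} {σ′} κ (i , i+j≡K , x≡ , y≡ , inv) nz = j , refl ,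
      (body κ′ i<K x≡ inv then λ {σ″} κ″ inv′ → run-≔
        (suc i , trans (sym (+-suc i j)) i+j≡K ,
         trans (update-same (regs σ″) x) (new κ″) ,
         trans (update-≢ᵇ (regs σ″) x x≢y) (trans (reg= κ″ y ky) y≡) ,
         subst (λ v → I (suc i) (setReg x v σ″)) (sym (new κ″)) inv′))
      where
      i<K : i < K
      i<K = subst (suc i ≤_) (trans (sym (+-suc i j)) i+j≡K) (s≤s (m≤m+n i j))
      new : ∀ {σ″} → Keeps c σ′ σ″ → regs σ″ x + 1 ≡ suc i
      new κ″ = trans (cong (_+ 1) (trans (reg= κ″ x kx) x≡)) (+-comm i 1)
      κ′ : Keeps (for x y c) σ σ′
      κ′ = keeping
        (λ z k → trans (reg= κ z (T-∧ʳ {not (x ≡ᵇ z)} k)) (update-≢ᵇ (regs σ) x (T-∧ˡ k)))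
        (λ a k → array= κ a k)

-- The program

-- Array 3 holds the depots, 4 the radices, 5 the row offsets of the matrix, 6
-- the values and 7 the choices of the dynamic program, 8 and 9 the digits of
-- the two states between which a transition is considered.  Digit 0 of a state
-- is v, digit 1 is d, digit 2 is j, and digit 3 + u tells whether the client u
-- has been visited (its radix is 1 if u is not a client).
rn rk rN rm ri rx rr rq rs rt ru rbad rδ rcand rbest rarg roff rl rpos rhead : ℕ
rn = 0
rk = 1
rN = 2
rm = 3
ri = 4
rx = 5
rr = 6
rq = 7
rs = 8
rt = 9
ru = 10
rbad = 11
rδ = 12
rcand = 13
rbest = 14
rarg = 15
roff = 16
rl = 17
rpos = 18
rhead = 19

neq : Exp → Exp → Exp
neq e₁ e₂ = (e₁ ⊖ e₂) ⊕ (e₂ ⊖ e₁)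

old new : ℕ → Exp
old i = load 8 (lit i)
new i = load 9 (lit i)

digitStep : ℕ → Cmd
digitStep b =
  (rr ≔ load 4 (reg ri)) ⨾
  (rq ≔ lit 0) ⨾
  while ((reg rx ⊕ lit 1) ⊖ reg rr)
    ((rx ≔ reg rx ⊖ reg rr) ⨾ (rq ≔ reg rq ⊕ lit 1)) ⨾
  store (8 + b) (reg ri) (reg rx) ⨾
  (rx ≔ reg rq)

decode : ℕ → ℕ → Cmd
decode b x = (rx ≔ reg x) ⨾ for ri rm (digitStep b)

-- A new bit `u` is legal only if `u` is the vertex being left and some vehicle is open; the second
-- condition matters because state 0 already stands on vertex 0 with no vehicle. Losing a bit is not
-- penalised: forgetting a visit only makes the goal harder to reach.
gains : Cmd
gains = for ru rn
  (cond (load 9 (lit 3 ⊕ reg ru) ⊖ load 8 (lit 3 ⊕ reg ru))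
    (rbad ≔ reg rbad ⊕ (neq (reg ru) (old 0) ⊕ (lit 1 ⊖ old 2)))
    skip)

-- The kind of step is read off the digits: a change of `j` means opening, otherwise a change of `v`
-- means moving, otherwise staying. Moving demands an open vehicle, so that tracing always has a
-- walk to extend.
transition : Cmd
transition =
  (rbad ≔ lit 0) ⨾ gains ⨾
  cond (reg rbad) (rδ ≔ lit 0)
    (cond (neq (new 2) (old 2))
      (cond (neq (new 2) (old 2 ⊕ lit 1) ⊕ (new 2 ⊖ reg rk) ⊕ neq (old 0) (old 1) ⊕ neq (new 0) (new 1))
        (rδ ≔ lit 0)
        (rδ ≔ load 3 (new 0)))
      (cond (neq (new 1) (old 1))
        (rδ ≔ lit 0)
        (cond (neq (new 0) (old 0))
          (cond (old 2)
            (rδ ≔ load 2 (load 5 (old 0) ⊕ new 0))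
            (rδ ≔ lit 0))
          (rδ ≔ lit 1))))

goalTest : Cmd
goalTest =
  (rbad ≔ neq (old 0) (old 1)) ⨾
  for ru rn (rbad ≔ reg rbad ⊕ (load 4 (lit 3 ⊕ reg ru) ⊖ lit 1 ⊖ load 8 (lit 3 ⊕ reg ru))) ⨾
  cond (reg rbad) (rδ ≔ lit 0) (rδ ≔ lit 1)

baseLayer : Cmd
baseLayer = for rs rN (decode 0 rs ⨾ goalTest ⨾ store 6 (reg rs) (reg rδ))

take : Cmd
take = (rbest ≔ reg rcand) ⨾ (rarg ≔ reg rt)

relax : Cmd
relax =
  decode 1 rt ⨾ transition ⨾
  cond (reg rδ)
    (cond (load 6 (reg roff ⊕ reg rt))
      ((rcand ≔ reg rδ ⊕ load 6 (reg roff ⊕ reg rt) ⊖ lit 1) ⨾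
       cond (reg rbest) (cond (reg rbest ⊖ reg rcand) take skip) take)
      skip)
    skip

cell : Cmd
cell =
  decode 0 rs ⨾ (rbest ≔ lit 0) ⨾ (rarg ≔ lit 0) ⨾ for rt rN relax ⨾
  store 6 (reg rN ⊕ reg roff ⊕ reg rs) (reg rbest) ⨾
  store 7 (reg rN ⊕ reg roff ⊕ reg rs) (reg rarg)

tables : Cmd
tables =
  baseLayer ⨾ (roff ≔ lit 0) ⨾
  for rl rN (for rs rN cell ⨾ (roff ≔ reg rN ⊕ reg roff))

-- A walk is preceded by its length, which is unknown when the walk begins; `rhead` remembers that
-- cell and every move increments it.
opening moving emit traceStep : Cmd
opening =
  (rhead ≔ reg rpos) ⨾
  store 0 (reg rhead) (lit 1) ⨾
  store 0 (lit 1 ⊕ reg rhead) (new 0) ⨾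
  (rpos ≔ lit 2 ⊕ reg rpos)
moving =
  store 0 (reg rhead) (lit 1 ⊕ load 0 (reg rhead)) ⨾
  store 0 (reg rpos) (new 0) ⨾
  (rpos ≔ lit 1 ⊕ reg rpos)
emit =
  store 1 (old 0) (old 2 ⊖ lit 1) ⨾
  cond (neq (new 2) (old 2)) opening (cond (neq (new 0) (old 0)) moving skip)
traceStep =
  (rt ≔ load 7 (reg roff ⊕ reg rs)) ⨾
  decode 0 rs ⨾ decode 1 rt ⨾ emit ⨾
  (rs ≔ reg rt) ⨾ (roff ≔ reg roff ⊖ reg rN)

output : Cmd
output =
  (rs ≔ lit 0) ⨾
  cond (load 6 (reg roff ⊕ reg rs))
    ((rpos ≔ lit 0) ⨾ (rhead ≔ lit 0) ⨾ for rl rN traceStep ⨾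
     decode 0 rs ⨾ (rk ≔ old 2) ⨾ (rn ≔ lit 1))
    (rn ≔ lit 0)

-- Arrays 0 and 1 will receive the answer, so later invariants refer to copies: the depots in array
-- 3, the clients through their radices in array 4.
prelude : Cmd
prelude =
  (rm ≔ lit 3 ⊕ reg rn) ⨾
  store 4 (lit 0) (reg rn) ⨾ store 4 (lit 1) (reg rn) ⨾ store 4 (lit 2) (lit 1 ⊕ reg rn) ⨾
  (rx ≔ lit 0) ⨾
  for ru rn
    (store 3 (reg ru) (load 0 (reg ru)) ⨾
     store 4 (lit 3 ⊕ reg ru) (lit 1 ⊕ load 1 (reg ru)) ⨾
     store 5 (reg ru) (reg rx) ⨾
     (rx ≔ reg rn ⊕ reg rx)) ⨾
  (rN ≔ lit 1) ⨾
  for ri rm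
    ((rx ≔ lit 0) ⨾ (rr ≔ load 4 (reg ri)) ⨾
     for ru rr (rx ≔ reg rN ⊕ reg rx) ⨾
     (rN ≔ reg rx))

program : Cmd
program = prelude ⨾ tables ⨾ output

-- Mixed radix numbers with the radices suc (ρ i)

quo dig : (ℕ → ℕ) → ℕ → ℕ → ℕ
quo ρ x zero    = x
quo ρ x (suc i) = quo ρ x i / suc (ρ i)
dig ρ x i = quo ρ x i % suc (ρ i)

quo≤ : ∀ ρ x i → quo ρ x i ≤ x
quo≤ ρ x zero    = ≤-refl
quo≤ ρ x (suc i) = ≤-trans (m/n≤m _ (suc (ρ i))) (quo≤ ρ x i)

module _ {x a b d : ℕ} .{{_ : NonZero d}} (a<d : a < d) (eq : x ≡ a + b * d) where
  %-unique : x % d ≡ a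
  %-unique = trans (cong (_% d) eq) (trans ([m+kn]%n≡m%n a b d) (m<n⇒m%n≡m a<d))

  /-unique : x / d ≡ b
  /-unique = trans (cong (_/ d) eq) (trans (+-distrib-/-∣ʳ a (n∣m*n b))
    (cong₂ _+_ (m<n⇒m/n≡0 a<d) (m*n/n≡m b d)))

update-≢ : ∀ {A : Set} (f : ℕ → A) {i j v} → i ≢ j → (f [ i ↦ v ]) j ≡ f j
update-≢ f {zero}  {zero}  i≢j = contradiction refl i≢j
update-≢ f {zero}  {suc j} i≢j = refl
update-≢ f {suc i} {zero}  i≢j = refl
update-≢ f {suc i} {suc j} i≢j = update-≢ (f ∘ suc) (i≢j ∘ cong suc)

<-suc-elim : ∀ {i j} → i < suc j → i < j ⊎ i ≡ j
<-suc-elim i<1+j = m≤n⇒m<n∨m≡n (s≤s⁻¹ i<1+j)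

update-extends : ∀ {f g : ℕ → ℕ} {i v} → (∀ {j} → j < i → f j ≡ g j) → v ≡ g i →
                 ∀ {j} → j < suc i → (f [ i ↦ v ]) j ≡ g j
update-extends {f} {i = i} f≡g v≡ j<1+i with <-suc-elim j<1+i
... | inj₁ j<i  = trans (update-≢ f (>⇒≢ j<i)) (f≡g j<i)
... | inj₂ refl = trans (update-same f i) v≡

-- The parameters are the relevant components of a state rather than the state itself. Hence `Ready`
-- is definitionally unchanged by an assignment to any other concrete register.
record Inputs (n′ k′ N′ m′ : ℕ) (B₂ B₃ B₄ B₅ : ℕ → ℕ)
              (n k N : ℕ) (A₂ A₃ A₄ A₅ : ℕ → ℕ) : Set where
  constructor inputs
  field
    n= : n′ ≡ n
    k= : k′ ≡ k
    N= : N′ ≡ N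
    m= : m′ ≡ 3 + n
    A₂= : B₂ ≡ A₂
    A₃= : B₃ ≡ A₃
    A₄= : B₄ ≡ A₄
    A₅= : B₅ ≡ A₅

open Inputs

module Machine (M n k N : ℕ) (A₂ A₃ A₄ A₅ ρ : ℕ → ℕ)
               (m≤M : 3 + n ≤ M) (N≤M : N ≤ M)
               (A₄-radix : ∀ {i} → i < 3 + n → A₄ i ≡ suc (ρ i)) where

  open Timed M

  Ready : State → Set
  Ready σ = Inputs (regs σ rn) (regs σ rk) (regs σ rN) (regs σ rm)
                   (arrays σ 2) (arrays σ 3) (arrays σ 4) (arrays σ 5)
                   n k N A₂ A₃ A₄ A₅

  still : ∀ {c σ σ′} → Ready σ → Keeps c σ σ′ →
          {_ : T (keepsReg rn c)} {_ : T (keepsReg rk c)} {_ : T (keepsReg rN c)} {_ : T (keepsReg rm c)}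
          {_ : T (keepsArray 2 c)} {_ : T (keepsArray 3 c)} {_ : T (keepsArray 4 c)} {_ : T (keepsArray 5 c)} →
          Ready σ′
  still r κ {a} {b} {c} {d} {e} {f} {g} {h} = inputs
    (trans (reg= κ rn a) (n= r)) (trans (reg= κ rk b) (k= r))
    (trans (reg= κ rN c) (N= r)) (trans (reg= κ rm d) (m= r))
    (trans (array= κ 2 e) (A₂= r)) (trans (array= κ 3 f) (A₃= r))
    (trans (array= κ 4 g) (A₄= r)) (trans (array= κ 5 h) (A₅= r))

  digit : ℕ → ℕ → ℕ
  digit = dig ρ

  Digits : (ℕ → ℕ) → ℕ → Set
  Digits f s = ∀ {i} → i < 3 + n → f i ≡ digit s i

  at-array : ∀ σ b {i v} → arrays (setCell (8 + b) i v σ) (8 + b) ≡ arrays σ (8 + b) [ i ↦ v ]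
  at-array σ b = update-same (arrays σ) (8 + b)

  -- Division by repeated subtraction. A radix is at least 1, so each round lowers `rx`, and `x ≤ M`
  -- bounds the rounds. On exit `rx` is below the radix, and the invariant then identifies remainder
  -- and quotient.
  run-digitStep : ∀ b {σ x i} → Ready σ → x ≤ M → i < 3 + n →
    regs σ ri ≡ i → regs σ rx ≡ quo ρ x i → (∀ {j} → j < i → arrays σ (8 + b) j ≡ digit x j) →
    Run (digitStep b) σ (λ σ′ → regs σ′ rx ≡ quo ρ x (suc i) ×
                                (∀ {j} → j < suc i → arrays σ′ (8 + b) j ≡ digit x j))
  run-digitStep b {σ} {x} {i} ready x≤M i<m i= x= before =
    run-⨾ (run-≔ (run-⨾ (run-≔ (
      run-while (λ j σ′ → regs σ′ rx ≤ j × x₀ ≡ regs σ′ rx + regs σ′ rq * d)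
        (λ {_} {σ′} κ (x≤j , eq) more → divide {σ′ = σ′} (trans (reg= κ rr _) radix) x≤j eq more)
        (≤-trans (≤-reflexive x=) (≤-trans (quo≤ ρ x i) x≤M))
        (≤-refl , trans (sym x=) (sym (+-identityʳ _)))
      then λ {σ′} κ (stop , _ , _ , eq) → run-⨾ (run-store (run-≔
        (let x<d = ≤-trans (≤-reflexive (sym (+-comm (regs σ′ rx) 1)))
                     (≤-trans (m∸n≡0⇒m≤n stop) (≤-reflexive (trans (reg= κ rr _) radix)))
         in sym (/-unique {b = regs σ′ rq} x<d eq) , λ {j} j<1+i → begin
           arrays (setCell (8 + b) (regs σ′ ri) (regs σ′ rx) σ′) (8 + b) j
             ≡⟨ cong (λ A → A j) (at-array σ′ b {regs σ′ ri}) ⟩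
           (arrays σ′ (8 + b) [ regs σ′ ri ↦ regs σ′ rx ]) j
             ≡⟨ cong (λ i′ → (arrays σ′ (8 + b) [ i′ ↦ regs σ′ rx ]) j) (trans (reg= κ ri _) i=) ⟩
           (arrays σ′ (8 + b) [ i ↦ regs σ′ rx ]) j
             ≡⟨ update-extends (λ {j} j<i → trans (cong (λ A → A j) (array= κ (8 + b) _)) (before j<i))
                               (sym (%-unique {b = regs σ′ rq} x<d eq)) j<1+i ⟩
           digit x j ∎)))))))
    where
    open ≡-Reasoning
    x₀ = quo ρ x i
    d = suc (ρ i)
    radix : arrays σ 4 (regs σ ri) ≡ d
    radix = trans (cong (arrays σ 4) i=) (trans (cong (λ A → A i) (A₄= ready)) (A₄-radix i<m))
    divide : ∀ {j σ′} → regs σ′ rr ≡ d → regs σ′ rx ≤ j → x₀ ≡ regs σ′ rx + regs σ′ rq * d →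
             regs σ′ rx + 1 ∸ regs σ′ rr ≢ 0 →
             ∃[ i ] j ≡ suc i × Run ((rx ≔ reg rx ⊖ reg rr) ⨾ (rq ≔ reg rq ⊕ lit 1)) σ′
               (λ σ″ → regs σ″ rx ≤ i × x₀ ≡ regs σ″ rx + regs σ″ rq * d)
    divide {j} {σ′} r= x≤j eq more = help (regs σ′ rr) (regs σ′ rx) r= x≤j eq more refl refl
      where
      -- The registers are generalised to variables so that `r` can be unified with `d` and `y`
      -- matched against `suc`.
      help : ∀ r y → r ≡ d → y ≤ j → x₀ ≡ y + regs σ′ rq * d → y + 1 ∸ r ≢ 0 → regs σ′ rr ≡ r → regs σ′ rx ≡ y →
             ∃[ i ] j ≡ suc i × Run ((rx ≔ reg rx ⊖ reg rr) ⨾ (rq ≔ reg rq ⊕ lit 1)) σ′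
               (λ σ″ → regs σ″ rx ≤ i × x₀ ≡ regs σ″ rx + regs σ″ rq * d)
      help r y refl y≤j eq more refl′ y= with d ≤? y
      ... | no d≰y = contradiction (m≤n⇒m∸n≡0 (≤-trans (≤-reflexive (+-comm y 1)) (≰⇒> d≰y))) more
      help r (suc y) refl (s≤s {n = j} y≤j) eq more r= y= | yes d≤y = j , refl ,
        run-⨾ (run-≔ (run-≔
          ( ≤-trans (≤-reflexive (cong₂ _∸_ y= r=)) (≤-trans (m∸n≤m y (ρ i)) y≤j)
          , (begin
              x₀                                              ≡⟨ eq ⟩
              suc y + q * d                                   ≡⟨ cong (_+ q * d) (m∸n+n≡m d≤y) ⟨
              suc y ∸ d + d + q * d                           ≡⟨ +-assoc (suc y ∸ d) d _ ⟩
              suc y ∸ d + suc q * d                           ≡⟨ cong₂ (λ z p → z + p * d)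
                                                                     (sym (cong₂ _∸_ y= r=)) (+-comm 1 q) ⟩
              regs σ′ rx ∸ regs σ′ rr + (q + 1) * d           ∎))))
        where
        q = regs σ′ rq

  run-decode : ∀ b y {σ x} → Ready σ → x ≤ M → regs σ y ≡ x →
               Run (decode b y) σ (λ σ′ → Digits (arrays σ′ (8 + b)) x)
  run-decode b y {σ} {x} ready x≤M y= = run-⨾ (run-≔ (weaken
    (run-for (λ i σ′ → regs σ′ rx ≡ quo ρ x i × (∀ {j} → j < i → arrays σ′ (8 + b) j ≡ digit x j))
      m≤M (m= ready) (y= , λ ())
      (λ {i} {σ′} κ i<m i= (x= , before) → run-digitStep b (still ready κ) x≤M i<m i= x= before))
    (λ _ → proj₂)))

-- The dynamic program

gap : ℕ → ℕ → ℕ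
gap i j = (i ∸ j) + (j ∸ i)

-- This function and the next ones copy the branches of the program, so the runs follow branch by
-- branch. Their combinatorial meaning is recovered later through `Legal`, `Decision` and the lemmas
-- on `missing`.
gains-step : (f g : ℕ → ℕ) (u bad : ℕ) → ℕ
gains-step f g u bad = if0 (g (3 + u) ∸ f (3 + u)) (bad + (gap u (f 0) + (1 ∸ f 2))) bad

illegal-gains : (f g : ℕ → ℕ) → ℕ → ℕ
illegal-gains f g zero    = 0
illegal-gains f g (suc u) = gains-step f g u (illegal-gains f g u)

decide : (k : ℕ) (A₂ A₃ A₅ : ℕ → ℕ) (bad : ℕ) (f g : ℕ → ℕ) → ℕ
decide k A₂ A₃ A₅ bad f g =
  if0 bad 0
    (if0 (gap (g 2) (f 2))
      (if0 (gap (g 2) (f 2 + 1) + (g 2 ∸ k) + gap (f 0) (f 1) + gap (g 0) (g 1)) 0 (A₃ (g 0)))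
      (if0 (gap (g 1) (f 1)) 0
        (if0 (gap (g 0) (f 0)) (if0 (f 2) (A₂ (A₅ (f 0) + g 0)) 0) 1)))

-- The term `A₄ (3 + u) ∸ 1` is the client bit of `u`, so a summand is positive exactly for an
-- unvisited client.
missing : (A₄ f : ℕ → ℕ) → ℕ → ℕ
missing A₄ f zero    = gap (f 0) (f 1)
missing A₄ f (suc u) = missing A₄ f u + (A₄ (3 + u) ∸ 1 ∸ f (3 + u))

module Optimum (N : ℕ) (c W : ℕ → ℕ) where

  -- b and p are the optimal value and choice among the successors below i,
  -- where values are shifted by one and 0 stands for infinity.
  record Best (i b p : ℕ) : Set where
    constructor best
    field
      sound    : b ≢ 0 → p < N × c p ≢ 0 × W p ≢ 0 × b ≡ c p + W p ∸ 1
      complete : ∀ {t} → t < i → c t ≢ 0 → W t ≢ 0 → b ≢ 0 × b ≤ c t + W t ∸ 1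

  open Best

  best-none : Best 0 0 0
  best-none = best (λ 0≢0 → contradiction refl 0≢0) λ ()

  module _ {i b p} (B : Best i b p) where

    best-skip : (c i ≡ 0 ⊎ W i ≡ 0) → Best (suc i) b p
    best-skip void = best (sound B) λ t<1+i c≢0 W≢0 → case (<-suc-elim t<1+i) c≢0 W≢0
      where
      case : ∀ {t} → t < i ⊎ t ≡ i → c t ≢ 0 → W t ≢ 0 → b ≢ 0 × b ≤ c t + W t ∸ 1
      case (inj₁ t<i)  c≢0 W≢0 = complete B t<i c≢0 W≢0
      case (inj₂ refl) c≢0 W≢0 = contradiction void [ c≢0 , W≢0 ]′

    best-keep : b ≢ 0 → b ≤ c i + W i ∸ 1 → Best (suc i) b p
    best-keep b≢0 b≤ = best (sound B) λ t<1+i c≢0 W≢0 → case (<-suc-elim t<1+i) c≢0 W≢0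
      where
      case : ∀ {t} → t < i ⊎ t ≡ i → c t ≢ 0 → W t ≢ 0 → b ≢ 0 × b ≤ c t + W t ∸ 1
      case (inj₁ t<i)  c≢0 W≢0 = complete B t<i c≢0 W≢0
      case (inj₂ refl) c≢0 W≢0 = b≢0 , b≤

    best-take : i < N → c i ≢ 0 → W i ≢ 0 → (b ≢ 0 → c i + W i ∸ 1 ≤ b) →
                Best (suc i) (c i + W i ∸ 1) i
    best-take i<N ci≢0 Wi≢0 better = best (λ _ → i<N , ci≢0 , Wi≢0 , refl)
      λ t<1+i c≢0 W≢0 → case (<-suc-elim t<1+i) c≢0 W≢0
      where
      positive : ∀ x y → x ≢ 0 → y ≢ 0 → x + y ∸ 1 ≢ 0
      positive zero    y       x≢0 y≢0 _ = x≢0 refl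
      positive (suc x) zero    x≢0 y≢0 _ = y≢0 refl
      positive (suc x) (suc y) x≢0 y≢0 e = contradiction (trans (sym (+-suc x y)) e) λ ()
      case : ∀ {t} → t < i ⊎ t ≡ i → c t ≢ 0 → W t ≢ 0 → c i + W i ∸ 1 ≢ 0 × c i + W i ∸ 1 ≤ c t + W t ∸ 1
      case (inj₁ t<i)  c≢0 W≢0 = let b≢0 , b≤ = complete B t<i c≢0 W≢0 in
        positive _ _ ci≢0 Wi≢0 , ≤-trans (better b≢0) b≤
      case (inj₂ refl) c≢0 W≢0 = positive _ _ ci≢0 Wi≢0 , ≤-refl

open Optimum using (Best; best; best-none; best-skip; best-keep; best-take) public

best-cong : ∀ {N c W W′ b p b′ p′} → (∀ {t} → t < N → W′ t ≡ W t) → b′ ≡ b → p′ ≡ p →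
            Best N c W N b p → Best N c W′ N b′ p′
best-cong {c = c} W= refl refl (best s t) = best
  (λ b≢0 → let p<N , c≢0 , W≢0 , eq = s b≢0 in
     p<N , c≢0 , (λ z → W≢0 (trans (sym (W= p<N)) z)) ,
     trans eq (cong (λ w → c _ + w ∸ 1) (sym (W= p<N))))
  (λ t<N c≢0 W≢0 → let b≢0 , b≤ = t t<N c≢0 (λ z → W≢0 (trans (W= t<N) z)) in
     b≢0 , ≤-trans b≤ (≤-reflexive (cong (λ w → c _ + w ∸ 1) (sym (W= t<N)))))

module Tables (M n k N : ℕ) (A₂ A₃ A₄ A₅ ρ : ℕ → ℕ)
              (m≤M : 3 + n ≤ M) (N≤M : N ≤ M)
              (A₄-radix : ∀ {i} → i < 3 + n → A₄ i ≡ suc (ρ i)) where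

  open Timed M
  open Machine M n k N A₂ A₃ A₄ A₅ ρ m≤M N≤M A₄-radix public

  n≤M : n ≤ M
  n≤M = ≤-trans (m≤n+m n 3) m≤M

  ψ : (ℕ → ℕ) → (ℕ → ℕ) → ℕ
  ψ f g = decide k A₂ A₃ A₅ (illegal-gains f g n) f g

  δ : ℕ → ℕ → ℕ
  δ s t = ψ (digit s) (digit t)

  goal : ℕ → ℕ
  goal s = if0 (missing A₄ (digit s) n) 0 1

  3+ : ∀ {u} → u < n → 3 + u < 3 + n
  3+ u<n = s≤s (s≤s (s≤s u<n))

  0< : 0 < 3 + n
  0< = s≤s z≤n
  1< : 1 < 3 + n
  1< = s≤s (s≤s z≤n)
  2< : 2 < 3 + n
  2< = s≤s (s≤s (s≤s z≤n))

  -- Decoded arrays agree with `digit` only below `3 + n`. This congruence and the two after it show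
  -- that transitions and goals look at no other positions.
  illegal-gains-cong : ∀ {f g f′ g′} → (∀ {i} → i < 3 + n → f i ≡ f′ i) → (∀ {i} → i < 3 + n → g i ≡ g′ i) →
                       ∀ {u} → u ≤ n → illegal-gains f g u ≡ illegal-gains f′ g′ u
  illegal-gains-cong p q {zero}  u≤n = refl
  illegal-gains-cong p q {suc u} u≤n
    rewrite illegal-gains-cong p q {u} (<⇒≤ u≤n) | p 0< | p 2< | p (3+ u≤n) | q (3+ u≤n) = refl

  ψ-cong : ∀ {f g f′ g′} → (∀ {i} → i < 3 + n → f i ≡ f′ i) → (∀ {i} → i < 3 + n → g i ≡ g′ i) →
           ψ f g ≡ ψ f′ g′
  ψ-cong p q rewrite illegal-gains-cong p q (≤-refl {n}) | p 0< | p 1< | p 2< | q 0< | q 1< | q 2< = refl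

  missing-cong : ∀ {f f′} → (∀ {i} → i < 3 + n → f i ≡ f′ i) → ∀ {u} → u ≤ n → missing A₄ f u ≡ missing A₄ f′ u
  missing-cong p {zero}  u≤n = cong₂ gap (p 0<) (p 1<)
  missing-cong p {suc u} u≤n = cong₂ (λ x y → x + (A₄ (3 + u) ∸ 1 ∸ y)) (missing-cong p (<⇒≤ u≤n)) (p (3+ u≤n))

  run-gains : ∀ {σ f g} → Ready σ → arrays σ 8 ≡ f → arrays σ 9 ≡ g → regs σ rbad ≡ 0 →
              Run gains σ (λ σ′ → regs σ′ rbad ≡ illegal-gains f g n)
  run-gains {σ} {f} {g} ready f= g= bad= =
    run-for (λ u σ′ → regs σ′ rbad ≡ illegal-gains f g u) n≤M (n= ready) bad=
      λ {u} {σ′} κ u<n u= bad= → weaken (run-cond-if0 {x = rbad} (run-≔ refl) (run-skip refl))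
        λ _ eq → trans eq (step-cong (trans (array= κ 8 _) f=) (trans (array= κ 9 _) g=) u= bad=)
    where
    step-cong : ∀ {f g f′ g′ u u′ b b′} → f ≡ f′ → g ≡ g′ → u ≡ u′ → b ≡ b′ →
                gains-step f g u b ≡ gains-step f′ g′ u′ b′
    step-cong refl refl refl refl = refl

  run-transition : ∀ {σ} → Ready σ → Run transition σ (λ σ′ → regs σ′ rδ ≡ ψ (arrays σ 8) (arrays σ 9))
  run-transition {σ} ready = run-⨾ (run-≔ (run-gains ready′ refl refl refl then λ κ bad= → weaken
    (run-cond-if0 {x = rδ} (run-≔ refl)
      (run-cond-if0 {x = rδ}
        (run-cond-if0 {x = rδ} (run-≔ refl) (run-≔ refl))
        (run-cond-if0 {x = rδ} (run-≔ refl)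
          (run-cond-if0 {x = rδ}
            (run-cond-if0 {x = rδ} (run-≔ refl) (run-≔ refl))
            (run-≔ refl)))))
    λ _ eq → let r = still ready′ κ in
      trans eq (decide-cong (k= r) (A₂= r) (A₃= r) (A₅= r) bad= (array= κ 8 _) (array= κ 9 _))))
    where
    ready′ : Ready (setReg rbad 0 σ)
    ready′ = ready
    decide-cong : ∀ {k A₂ A₃ A₅ b f g k′ A₂′ A₃′ A₅′ b′ f′ g′} → k ≡ k′ → A₂ ≡ A₂′ → A₃ ≡ A₃′ → A₅ ≡ A₅′ →
                  b ≡ b′ → f ≡ f′ → g ≡ g′ → decide k A₂ A₃ A₅ b f g ≡ decide k′ A₂′ A₃′ A₅′ b′ f′ g′
    decide-cong refl refl refl refl refl refl refl = refl

  run-goalTest : ∀ {σ} → Ready σ →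
                 Run goalTest σ (λ σ′ → regs σ′ rδ ≡ if0 (missing A₄ (arrays σ 8) n) 0 1)
  run-goalTest {σ} ready = run-⨾ (run-≔
    (run-for (λ u σ′ → regs σ′ rbad ≡ missing A₄ f u) n≤M (n= ready) refl
      (λ {u} {σ′} κ u<n u= bad= → run-≔ (step-cong bad= (trans (array= κ 4 _) (A₄= ready)) (array= κ 8 _) u=))
    then λ κ bad= → weaken (run-cond-if0 {x = rδ} (run-≔ refl) (run-≔ refl))
      λ _ eq → trans eq (cong (λ b → if0 b 0 1) bad=)))
    where
    f = arrays σ 8
    step-cong : ∀ {b b′ A A′ f f′ u u′} → b ≡ b′ → A ≡ A′ → f ≡ f′ → u ≡ u′ →
                b + (A (3 + u) ∸ 1 ∸ f (3 + u)) ≡ b′ + (A′ (3 + u′) ∸ 1 ∸ f′ (3 + u′))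
    step-cong refl refl refl refl = refl

  run-baseLayer : ∀ {σ} → Ready σ → Run baseLayer σ (λ σ′ → ∀ {s} → s < N → arrays σ′ 6 s ≡ goal s)
  run-baseLayer ready = run-for (λ s σ′ → ∀ {t} → t < s → arrays σ′ 6 t ≡ goal t) N≤M (N= ready) (λ ())
    λ {s} {σ′} κ s<N s= before →
      run-decode 0 rs (still ready κ) (≤-trans (<⇒≤ s<N) N≤M) s= then λ κ₁ digits →
      run-goalTest (still (still ready κ) κ₁) then λ {σ″} κ₂ value → run-store λ {t} t<1+s →
        subst (λ i → (arrays σ″ 6 [ i ↦ regs σ″ rδ ]) t ≡ goal t)
          (sym (trans (reg= κ₂ rs _) (trans (reg= κ₁ rs _) s=)))
          (update-extends {f = arrays σ″ 6}
            (λ {j} j<s → trans (cong (λ A → A j) (trans (array= κ₂ 6 _) (array= κ₁ 6 _))) (before j<s))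
            (trans value (cong (λ b → if0 b 0 1) (missing-cong digits ≤-refl))) t<1+s)

  run-relax : ∀ {σ s o t b p} → Ready σ → Digits (arrays σ 8) s → regs σ roff ≡ o → t < N → regs σ rt ≡ t →
              regs σ rbest ≡ b → regs σ rarg ≡ p →
              let Best′ = Best N (δ s) (λ t → arrays σ 6 (o + t)) in
              Best′ t b p → Run relax σ (λ σ′ → Best′ (suc t) (regs σ′ rbest) (regs σ′ rarg))
  run-relax {σ} {s} {o} {t} ready digits o= t<N t= refl refl B =
    run-decode 1 rt ready (≤-trans (<⇒≤ t<N) N≤M) t= then λ {σ₁} κ₁ digits′ →
    run-transition (still ready κ₁) then λ {σ₂} κ₂ value →
    let b=  = trans (reg= κ₂ rbest _) (reg= κ₁ rbest _)
        p=  = trans (reg= κ₂ rarg _) (reg= κ₁ rarg _)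
        t=′ = trans (reg= κ₂ rt _) (trans (reg= κ₁ rt _) t=)
        c=  = trans value (ψ-cong (λ i< → trans (cong (λ A → A _) (array= κ₁ 8 _)) (digits i<)) digits′)
        W=  = cong₂ (λ A i → A i) (trans (array= κ₂ 6 _) (array= κ₁ 6 _))
                (cong₂ _+_ (trans (reg= κ₂ roff _) (trans (reg= κ₁ roff _) o=)) t=′)
    in choose σ₂ b= p= t=′ c= W=
    where
    W : ℕ → ℕ
    W t = arrays σ 6 (o + t)
    Best′ = Best N (δ s) W
    choose : ∀ σ₂ → regs σ₂ rbest ≡ regs σ rbest → regs σ₂ rarg ≡ regs σ rarg → regs σ₂ rt ≡ t →
             regs σ₂ rδ ≡ δ s t → arrays σ₂ 6 (regs σ₂ roff + regs σ₂ rt) ≡ W t →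
             Run (cond (reg rδ)
                    (cond (load 6 (reg roff ⊕ reg rt))
                      ((rcand ≔ reg rδ ⊕ load 6 (reg roff ⊕ reg rt) ⊖ lit 1) ⨾
                       cond (reg rbest) (cond (reg rbest ⊖ reg rcand) take skip) take)
                      skip)
                    skip) σ₂ (λ σ′ → Best′ (suc t) (regs σ′ rbest) (regs σ′ rarg))
    choose σ₂ b= p= t= c= W= = run-cond
      (λ c≢0 → run-cond
        (λ W≢0 → run-⨾ (run-≔ (run-cond
          (λ b≢0 → run-cond
            (λ better → taking (c≢0 ∘ trans c=) (W≢0 ∘ trans W=)
               λ _ → ≤-trans (≤-reflexive (sym cand=)) (≤-trans (<⇒≤ (m∸n≢0⇒n<m better)) (≤-reflexive b=)))
            (λ worse → run-skip (subst₂ (Best′ (suc t)) (sym b=) (sym p=)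
              (best-keep N (δ s) W B (b≢0 ∘ trans b=)
                (≤-trans (≤-reflexive (sym b=)) (≤-trans (m∸n≡0⇒m≤n worse) (≤-reflexive cand=)))))))
          (λ b≡0 → taking (c≢0 ∘ trans c=) (W≢0 ∘ trans W=) λ b≢0 → contradiction (trans (sym b=) b≡0) b≢0))))
        (λ W≡0 → skipping (inj₂ (trans (sym W=) W≡0))))
      (λ c≡0 → skipping (inj₁ (trans (sym c=) c≡0)))
      where
      cand= : regs σ₂ rδ + arrays σ₂ 6 (regs σ₂ roff + regs σ₂ rt) ∸ 1 ≡ δ s t + W t ∸ 1
      cand= = cong (_∸ 1) (cong₂ _+_ c= W=)
      skipping : (δ s t ≡ 0 ⊎ W t ≡ 0) → Run skip σ₂ (λ σ′ → Best′ (suc t) (regs σ′ rbest) (regs σ′ rarg))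
      skipping void = run-skip (subst₂ (Best′ (suc t)) (sym b=) (sym p=) (best-skip N (δ s) W B void))
      taking : δ s t ≢ 0 → W t ≢ 0 → (regs σ rbest ≢ 0 → δ s t + W t ∸ 1 ≤ regs σ rbest) →
               Run take (setReg rcand (regs σ₂ rδ + arrays σ₂ 6 (regs σ₂ roff + regs σ₂ rt) ∸ 1) σ₂)
                 (λ σ′ → Best′ (suc t) (regs σ′ rbest) (regs σ′ rarg))
      taking c≢0 W≢0 better = run-⨾ (run-≔ (run-≔ (subst₂ (Best′ (suc t)) (sym cand=) (sym t=)
        (best-take N (δ s) W B t<N c≢0 W≢0 better))))

  -- Layer `l` starts at `l * N` and concerns paths of exactly `l` steps. The statement is about an
  -- entry of layer `suc l`; the position is written `N + l * N + s` because `suc l * N` unfolds to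
  -- that form.
  Correct : (A₆ A₇ : ℕ → ℕ) → ℕ → ℕ → Set
  Correct A₆ A₇ l s = Best N (δ s) (λ t → A₆ (l * N + t)) N (A₆ (N + l * N + s)) (A₇ (N + l * N + s))

  record Filled (l s : ℕ) (A₆ A₇ : ℕ → ℕ) : Set where
    constructor filled
    field
      base     : ∀ {t} → t < N → A₆ t ≡ goal t
      previous : ∀ {l′ t} → l′ < l → t < N → Correct A₆ A₇ l′ t
      current  : ∀ {t} → t < s → t < N → Correct A₆ A₇ l t

  open Filled

  update-above : ∀ (A : ℕ → ℕ) {i v j} → j < i → (A [ i ↦ v ]) j ≡ A j
  update-above A j<i = update-≢ A (>⇒≢ j<i)

  correct-cong : ∀ A₆ A₇ l {t i b p} → t < N → N + l * N + t < i → Correct A₆ A₇ l t →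
                 Correct (A₆ [ i ↦ b ]) (A₇ [ i ↦ p ]) l t
  correct-cong A₆ A₇ l {t} t<N below = best-cong
    (λ {t′} t′<N → update-above A₆ (≤-trans (s≤s (≤-trans (+-monoʳ-≤ (l * N) (<⇒≤ t′<N))
        (≤-trans (≤-reflexive (+-comm (l * N) N)) (m≤m+n _ t)))) below))
    (update-above A₆ below) (update-above A₇ below)

  -- Cells are written in increasing order, so the layers and entries that earlier claims mention
  -- all lie below the new cell and survive the update.
  filled-step : ∀ {l s A₆ A₇ b p} → s < N → Filled l s A₆ A₇ →
                Best N (δ s) (λ t → A₆ (l * N + t)) N b p →
                Filled l (suc s) (A₆ [ N + l * N + s ↦ b ]) (A₇ [ N + l * N + s ↦ p ])
  filled-step {l} {s} {A₆} {A₇} s<N F B = filled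
    (λ t<N → trans (update-above A₆ (<-≤-trans t<N (≤-trans (m≤m+n N (l * N)) (m≤m+n _ s)))) (base F t<N))
    (λ {l′} {t} l′<l t<N → correct-cong A₆ A₇ l′ t<N
      (<-≤-trans (+-monoʳ-< (N + l′ * N) t<N)
        (≤-trans (≤-reflexive (+-comm (N + l′ * N) N))
          (≤-trans (+-monoʳ-≤ N (*-monoˡ-≤ N l′<l)) (m≤m+n _ s))))
      (previous F l′<l t<N))
    λ t<1+s t<N → now (<-suc-elim t<1+s) t<N
    where
    now : ∀ {t} → t < s ⊎ t ≡ s → t < N →
          Correct (A₆ [ N + l * N + s ↦ _ ]) (A₇ [ N + l * N + s ↦ _ ]) l t
    now (inj₁ t<s) t<N = correct-cong A₆ A₇ l t<N (+-monoʳ-< (N + l * N) t<s) (current F t<s t<N)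
    now (inj₂ refl) t<N = best-cong
      (λ {t′} t′<N → update-above A₆ (<-≤-trans (+-monoʳ-< (l * N) t′<N)
        (≤-trans (≤-reflexive (+-comm (l * N) N)) (m≤m+n _ s))))
      (update-same A₆ (N + l * N + s)) (update-same A₇ (N + l * N + s)) B

  run-cell : ∀ {σ l s} → Ready σ → regs σ roff ≡ l * N → s < N → regs σ rs ≡ s →
             Filled l s (arrays σ 6) (arrays σ 7) →
             Run cell σ (λ σ′ → Filled l (suc s) (arrays σ′ 6) (arrays σ′ 7))
  run-cell {σ} {l} {s} ready o= s<N s= F =
    run-decode 0 rs ready (≤-trans (<⇒≤ s<N) N≤M) s= then λ {σ₁} κ₁ digits →
    let ready₁ = still ready κ₁ in
    run-⨾ (run-≔ (run-⨾ (run-≔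
      (run-for (λ t σ′ → Best N (δ s) (λ t → arrays σ₁ 6 (l * N + t)) t (regs σ′ rbest) (regs σ′ rarg))
         N≤M (N= ready₁) (best-none N (δ s) _)
         (λ {t} {σ′} κ t<N t= B → weaken
           (run-relax {s = s} (still ready₁ κ) (λ i< → trans (cong (λ A → A _) (array= κ 8 _)) (digits i<))
              (trans (reg= κ roff _) (trans (reg= κ₁ roff _) o=)) t<N t= refl refl
              (subst (λ A → Best N (δ s) (λ t → A (l * N + t)) t (regs σ′ rbest) (regs σ′ rarg))
                 (sym (array= κ 6 _)) B))
           λ {σ″} _ → subst (λ A → Best N (δ s) (λ t → A (l * N + t)) (suc t) (regs σ″ rbest) (regs σ″ rarg))
                    (array= κ 6 _))
      then λ {σ₂} κ₂ B → run-⨾ (run-store (run-store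
        (let pos = cong₂ _+_ (cong₂ _+_ (N= (still ready₁ κ₂))
                     (trans (reg= κ₂ roff _) (trans (reg= κ₁ roff _) o=)))
                     (trans (reg= κ₂ rs _) (trans (reg= κ₁ rs _) s=))
             A₆=σ = trans (array= κ₂ 6 _) (array= κ₁ 6 _)
             A₇=σ = trans (array= κ₂ 7 _) (array= κ₁ 7 _)
         in subst (λ i → Filled l (suc s) (arrays σ₂ 6 [ i ↦ regs σ₂ rbest ]) (arrays σ₂ 7 [ i ↦ regs σ₂ rarg ]))
              (sym pos)
              (filled-step s<N (subst₂ (Filled l s) (sym A₆=σ) (sym A₇=σ) F)
                 (subst (λ A → Best N (δ s) (λ t → A (l * N + t)) N (regs σ₂ rbest) (regs σ₂ rarg))
                   (sym (array= κ₂ 6 _)) B)))))))))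

  run-tables : ∀ {σ} → Ready σ →
               Run tables σ (λ σ′ → regs σ′ roff ≡ N * N × Filled N 0 (arrays σ′ 6) (arrays σ′ 7))
  run-tables ready = run-baseLayer ready then λ {σ₁} κ₁ base₁ → let ready₁ = still ready κ₁ in
    run-⨾ (run-≔ (run-for (λ l σ′ → regs σ′ roff ≡ l * N × Filled l 0 (arrays σ′ 6) (arrays σ′ 7)) N≤M (N= ready₁)
      (refl , filled base₁ (λ ()) (λ ()))
      λ {l} {σ′} κ l<N _ (o= , F) → let ready′ = still ready₁ κ in
        run-for (λ s σ″ → Filled l s (arrays σ″ 6) (arrays σ″ 7)) N≤M (N= ready′) F
          (λ {s} κ₂ s<N s= F′ → run-cell (still ready′ κ₂) (trans (reg= κ₂ roff _) o=) s<N s= F′)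
        then λ κ₃ F″ → run-≔
          ( cong₂ _+_ (N= (still ready′ κ₃)) (trans (reg= κ₃ roff _) o=)
          , filled (base F″) (λ l′<1+l t<N → [ (λ l′<l → previous F″ l′<l t<N)
                                              , (λ { refl → current F″ t<N t<N }) ]′ (<-suc-elim l′<1+l)) (λ ()))))

-- Paths in the state graph

capacity : (ℕ → ℕ) → ℕ → ℕ
capacity ρ zero    = 1
capacity ρ (suc m) = suc (ρ 0) * capacity (ρ ∘ suc) m

-- `encode` recurses on the lowest digit, whereas the prelude multiplies by the radices in
-- increasing order; this identity reconciles the two.
capacity-suc : ∀ ρ m → capacity ρ (suc m) ≡ suc (ρ m) * capacity ρ m
capacity-suc ρ zero    = refl
capacity-suc ρ (suc m) = trans (cong (suc (ρ 0) *_) (capacity-suc (ρ ∘ suc) m))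
  (x∙yz≈y∙xz (suc (ρ 0)) (suc (ρ (suc m))) (capacity (ρ ∘ suc) m))
  where open import Algebra.Properties.CommutativeSemigroup *-commutativeSemigroup

quo-suc : ∀ ρ x i → quo ρ x (suc i) ≡ quo (ρ ∘ suc) (x / suc (ρ 0)) i
quo-suc ρ x zero    = refl
quo-suc ρ x (suc i) = cong (_/ suc (ρ (suc i))) (quo-suc ρ x i)

quo-0 : ∀ ρ i → quo ρ 0 i ≡ 0
quo-0 ρ i = n≤0⇒n≡0 (quo≤ ρ 0 i)

encode : ∀ ρ m (f : ℕ → ℕ) → (∀ {i} → i < m → f i ≤ ρ i) →
         ∃[ x ] x < capacity ρ m × (∀ {i} → i < m → dig ρ x i ≡ f i)
encode ρ zero    f f≤ρ = 0 , ≤-refl , λ ()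
encode ρ (suc m) f f≤ρ with encode (ρ ∘ suc) m (f ∘ suc) (f≤ρ ∘ s≤s)
... | x , x< , digits = f 0 + x * d , below , digits′
  where
  d = suc (ρ 0)
  below : f 0 + x * d < d * capacity (ρ ∘ suc) m
  below = begin-strict
    f 0 + x * d                 <⟨ +-monoˡ-< (x * d) (s≤s (f≤ρ z<s)) ⟩
    suc x * d                   ≤⟨ *-monoˡ-≤ d x< ⟩
    capacity (ρ ∘ suc) m * d    ≡⟨ *-comm _ d ⟩
    d * capacity (ρ ∘ suc) m    ∎
    where open ≤-Reasoning
  digits′ : ∀ {i} → i < suc m → dig ρ (f 0 + x * d) i ≡ f i
  digits′ {zero}  _         = %-unique {b = x} (s≤s (f≤ρ z<s)) refl
  digits′ {suc i} (s≤s i<m) = trans (cong (_% suc (ρ (suc i))) (trans (quo-suc ρ (f 0 + x * d) i)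
    (cong (λ y → quo (ρ ∘ suc) y i) (/-unique {b = x} (s≤s (f≤ρ z<s)) refl)))) (digits i<m)

lookup-injective : ∀ {A : Set} {xs : List A} → Unique xs → ∀ i j → lookup xs i ≡ lookup xs j → i ≡ j
lookup-injective (_ ∷ _)   zero    zero    eq = refl
lookup-injective (x∉ ∷ _)  zero    (suc j) eq = contradiction eq (All.lookup x∉ (∈-lookup j))
lookup-injective (x∉ ∷ _)  (suc i) zero    eq = contradiction (sym eq) (All.lookup x∉ (∈-lookup i))
lookup-injective (_ ∷ u)   (suc i) (suc j) eq = cong suc (lookup-injective u i j eq)

-- An assignment takes a membership proof as argument. Irrelevance makes the vehicle a function of
-- the client alone, which the pigeonhole argument on vehicles relies on.
∈-irrelevant : ∀ {n} {p : Subset n} {c} (c∈p c∈p′ : c ∈ p) → c∈p ≡ c∈p′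
∈-irrelevant here      here       = refl
∈-irrelevant (there x) (there y)  = cong there (∈-irrelevant x y)

module Shortening (N : ℕ) (δ : ℕ → ℕ → ℕ) (goal : ℕ → ℕ) where

  data Path (s : ℕ) : ℕ → ℕ → Set where
    stop : goal s ≡ 1 → Path s 0 0
    step : ∀ {t w l c} → t < N → δ s t ≡ suc w → Path t l c → Path s (suc l) (w + c)

  states : ∀ {s l c} → Path s l c → List ℕ
  states {s} (stop _)     = s ∷ []
  states {s} (step _ _ p) = s ∷ states p

  length-states : ∀ {s l c} (p : Path s l c) → length (states p) ≡ suc l
  length-states (stop _)     = refl
  length-states (step _ _ p) = cong suc (length-states p)

  states< : ∀ {s l c} → s < N → (p : Path s l c) → All (_< N) (states p)
  states< s<N (stop _)       = s<N ∷ []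
  states< s<N (step t<N _ p) = s<N ∷ states< t<N p

  Simple : ℕ → ℕ → Set
  Simple s c = ∃[ l ] ∃[ c′ ] Σ[ p ∈ Path s l c′ ] c′ ≤ c × Unique (states p)

  suffix : ∀ {s t l c} (p : Path t l c) → Unique (states p) → s List.∈ states p → Simple s c
  suffix p@(stop _)       u       (here refl) = _ , _ , p , ≤-refl , u
  suffix p@(step _ _ _)   u       (here refl) = _ , _ , p , ≤-refl , u
  suffix (step _ _ p)     (_ ∷ u) (there s∈p) =
    let l , c , p′ , c≤ , u′ = suffix p u s∈p in l , c , p′ , m≤n⇒m≤o+n _ c≤ , u′

  simplify : ∀ {s l c} → Path s l c → Simple s c
  simplify p@(stop _) = _ , _ , p , ≤-refl , [] ∷ []
  simplify {s} (step {w = w} t<N e p) with simplify p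
  ... | l , c , p′ , c≤ , u with member? _≟_ s (states p′)
  ... | no s∉p′ = _ , _ , step t<N e p′ , +-monoʳ-≤ w c≤ , ¬Any⇒All¬ _ s∉p′ ∷ u
  ... | yes s∈p′ = let l , c , p″ , c≤′ , u′ = suffix p′ u s∈p′ in
    l , c , p″ , m≤n⇒m≤o+n w (≤-trans c≤′ c≤) , u′

  unique-length : ∀ {xs} → Unique xs → All (_< N) xs → length xs ≤ N
  unique-length {xs} u below = injective⇒≤ {f = λ i → fromℕ< (bounded i)}
    λ {i} {j} eq → lookup-injective u i j (fromℕ<-injective _ _ (bounded i) (bounded j) eq)
    where
    bounded : ∀ i → lookup xs i < N
    bounded i = All.lookup below (∈-lookup i)

  -- A path with `l` steps lists `l + 1` states; if they are distinct there are at most `N` of them,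
  -- hence the strict bound.
  shorten : ∀ {s l c} → s < N → Path s l c → ∃[ l′ ] ∃[ c′ ] Path s l′ c′ × l′ < N × c′ ≤ c
  shorten s<N p = let l , c , p′ , c≤ , u = simplify p in
    l , c , p′ , ≤-trans (≤-reflexive (sym (length-states p′))) (unique-length u (states< s<N p′)) , c≤

-- The input arrays as functions of the instance

characteristic-≤1 : ∀ {n} (p : Subset n) i → fromList (characteristic p) i ≤ 1
characteristic-≤1 []            i       = z≤n
characteristic-≤1 (true ∷ p)    zero    = ≤-refl
characteristic-≤1 (false ∷ p)   zero    = z≤n
characteristic-≤1 (b ∷ p)       (suc i) = characteristic-≤1 p i

characteristic-∈ : ∀ {n} {p : Subset n} {c} → c ∈ p → fromList (characteristic p) (toℕ c) ≡ 1
characteristic-∈ here        = refl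
characteristic-∈ (there c∈p) = characteristic-∈ c∈p

characteristic-∈⁻ : ∀ {n} (p : Subset n) c → fromList (characteristic p) (toℕ c) ≢ 0 → c ∈ p
characteristic-∈⁻ (true ∷ p)  zero    nz = here
characteristic-∈⁻ (false ∷ p) zero    nz = contradiction refl nz
characteristic-∈⁻ (b ∷ p)     (suc c) nz = there (characteristic-∈⁻ p c nz)

fromList-++ˡ : ∀ xs ys {i} → i < length xs → fromList (xs ++ ys) i ≡ fromList xs i
fromList-++ˡ (x ∷ xs) ys {zero}  _         = refl
fromList-++ˡ (x ∷ xs) ys {suc i} (s≤s i<l) = fromList-++ˡ xs ys i<l

fromList-++ʳ : ∀ xs ys i → fromList (xs ++ ys) (length xs + i) ≡ fromList ys i
fromList-++ʳ []       ys i = refl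
fromList-++ʳ (x ∷ xs) ys i = fromList-++ʳ xs ys i

fromList-tabulate : ∀ {n} (f : Fin n → ℕ) v → fromList (tabulate f) (toℕ v) ≡ f v
fromList-tabulate f zero    = refl
fromList-tabulate f (suc v) = fromList-tabulate (f ∘ suc) v

fromList-rows : ∀ {m n} (f : Fin m → Fin n → ℕ) u v →
                fromList (concat (tabulate λ u → tabulate (f u))) (toℕ u * n + toℕ v) ≡ f u v
fromList-rows {n = n} f zero v = trans
  (fromList-++ˡ (tabulate (f zero)) _ (<-≤-trans (toℕ<n v) (≤-reflexive (sym (length-tabulate (f zero))))))
  (fromList-tabulate (f zero) v)
fromList-rows {n = n} f (suc u) v = trans
  (cong (fromList (tabulate (f zero) ++ rest))
    (trans (+-assoc n (toℕ u * n) (toℕ v)) (cong (_+ _) (sym (length-tabulate (f zero))))))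
  (trans (fromList-++ʳ (tabulate (f zero)) rest _) (fromList-rows (f ∘ suc) u v))
  where rest = concat (tabulate λ u → tabulate (f (suc u)))

sum-punchIn : ∀ {m} (f : Fin (suc m) → ℕ) i → sum (tabulate (f ∘ punchIn i)) ≤ sum (tabulate f)
sum-punchIn {m}     f zero    = m≤n+m _ (f zero)
sum-punchIn {suc m} f (suc i) = +-monoʳ-≤ (f zero) (sum-punchIn (f ∘ suc) i)

-- Discarding idle vehicles

module _ {I : Instance} where
  open Instance I
  open Routing

  private
    serving? : (R : Routing I) → ∀ i → Dec (∃[ c ] ∃[ c∈C ] assign R c c∈C ≡ i)
    serving? R i = any? λ c → serves? c (c ∈? clients)
      where
      serves? : ∀ c → Dec (c ∈ clients) → Dec (∃[ c∈C ] assign R c c∈C ≡ i)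
      serves? c (no c∉C) = no (c∉C ∘ proj₁)
      serves? c (yes c∈C) with assign R c c∈C Fin.≟ i
      ... | yes eq = yes (c∈C , eq)
      ... | no neq = no λ (c∈C′ , eq) → neq (trans (cong (assign R c) (∈-irrelevant c∈C c∈C′)) eq)

  -- If every vehicle served some client, choosing one client per vehicle would inject the vehicles
  -- into the `n` vertices.
  unused-vehicle : (R : Routing I) → ¬ (k′ R ≤ n) → ∃[ i ] ∀ c c∈C → assign R c c∈C ≢ i
  unused-vehicle R k′≰n =
    let i , idle = ¬∀⟶∃¬ _ _ (serving? R) all-busy⇒≤
    in i , λ c c∈C eq → idle (c , c∈C , eq)
    where
    all-busy⇒≤ : ¬ (∀ i → ∃[ c ] ∃[ c∈C ] assign R c c∈C ≡ i)
    all-busy⇒≤ busy = k′≰n (injective⇒≤ {f = proj₁ ∘ busy} inj)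
      where
      inj : ∀ {i j} → proj₁ (busy i) ≡ proj₁ (busy j) → i ≡ j
      inj {i} {j} eq with busy i | busy j
      inj refl | c , c∈C , refl | .c , c∈C′ , refl = cong (assign R c) (∈-irrelevant c∈C c∈C′)

  drop-vehicle : (R : Routing I) → ∀ m → k′ R ≡ suc m → (∃[ i ] ∀ c c∈C → assign R c c∈C ≢ i) →
                 Σ[ R′ ∈ Routing I ] k′ R′ ≡ m × weight R′ ≤ weight R
  drop-vehicle record { k′ = .(suc m) ; k′≤k = k′≤k ; start = start ; start∈D = start∈D
                      ; walk = walk ; assign = assign ; visits = visits } m refl (i , idle) =
    record
      { k′      = m
      ; k′≤k    = ≤-trans (n≤1+n m) k′≤k
      ; start   = start ∘ punchIn i
      ; start∈D = start∈D ∘ punchIn i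
      ; walk    = walk ∘ punchIn i
      ; assign  = λ c c∈C → punchOut (i≢ c c∈C)
      ; visits  = λ c c∈C → subst (λ j → c List.∈ vertices (walk j))
                    (sym (punchIn-punchOut (i≢ c c∈C))) (visits c c∈C)
      } , refl , sum-punchIn (walkWeight ∘ walk) i
    where
    i≢ : ∀ c c∈C → i ≢ assign c c∈C
    i≢ c c∈C eq = idle c c∈C (sym eq)

  few-vehicles : (R : Routing I) → Σ[ R′ ∈ Routing I ] k′ R′ ≤ n × weight R′ ≤ weight R
  few-vehicles R = go (k′ R) R refl
    where
    go : ∀ m R → k′ R ≡ m → Σ[ R′ ∈ Routing I ] k′ R′ ≤ n × weight R′ ≤ weight R
    go m R eq with k′ R ≤? n
    ... | yes k′≤n = R , k′≤n , ≤-refl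
    go zero R eq | no k′≰n = contradiction (≤-trans (≤-reflexive eq) z≤n) k′≰n
    go (suc m) R eq | no k′≰n =
      let R′ , eq′ , ≤₁ = drop-vehicle R m eq (unused-vehicle R k′≰n)
          R″ , k″≤n , ≤₂ = go m R′ eq′
      in R″ , k″≤n , ≤-trans ≤₂ ≤₁

-- The meaning of transition values

gap-≡ : ∀ {i j} → i ≡ j → gap i j ≡ 0
gap-≡ {i} refl = cong₂ _+_ (n∸n≡0 i) (n∸n≡0 i)

gap≡0 : ∀ {i j} → gap i j ≡ 0 → i ≡ j
gap≡0 {i} {j} z = ≤-antisym (m∸n≡0⇒m≤n (m+n≡0⇒m≡0 (i ∸ j) z)) (m∸n≡0⇒m≤n (m+n≡0⇒n≡0 (i ∸ j) z))

module Decisions (k : ℕ) (A₂ A₃ A₅ : ℕ → ℕ) {bad : ℕ} {f g : ℕ → ℕ} where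

  -- Hypotheses with `gap` repeat the tests of the program verbatim, even where they follow from the
  -- equations, so that a constructor directly contradicts a branch of `emit` that does not belong
  -- to it.
  data Decision (v : ℕ) : Set where
    opened : gap (g 2) (f 2) ≢ 0 → g 2 ≡ suc (f 2) → g 2 ≤ k → f 0 ≡ f 1 → g 0 ≡ g 1 → v ≡ A₃ (g 0) → Decision v
    moved  : gap (g 2) (f 2) ≡ 0 → g 1 ≡ f 1 → gap (g 0) (f 0) ≢ 0 → f 2 ≢ 0 → v ≡ A₂ (A₅ (f 0) + g 0) → Decision v
    stayed : gap (g 2) (f 2) ≡ 0 → g 1 ≡ f 1 → gap (g 0) (f 0) ≡ 0 → v ≡ 1 → Decision v

  decision : bad ≡ 0 → ∀ {v} → Decision v → decide k A₂ A₃ A₅ bad f g ≡ v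
  decision refl (opened j≢ j≡ j≤k p q refl) = trans (if0-≢0 j≢) (if0-≡0 (cong₂ _+_ (cong₂ _+_ (cong₂ _+_
    (gap-≡ (trans j≡ (+-comm 1 (f 2)))) (m≤n⇒m∸n≡0 j≤k)) (gap-≡ p)) (gap-≡ q)))
  decision refl (moved j≡ d≡ v≢ j≢0 refl) =
    trans (if0-≡0 j≡) (trans (if0-≡0 (gap-≡ d≡)) (trans (if0-≢0 v≢) (if0-≢0 j≢0)))
  decision refl (stayed j≡ d≡ v≡ refl) = trans (if0-≡0 j≡) (trans (if0-≡0 (gap-≡ d≡)) (if0-≡0 v≡))

  decision⁻ : ∀ {v} → decide k A₂ A₃ A₅ bad f g ≡ v → v ≢ 0 → bad ≡ 0 × Decision v
  decision⁻ refl = split bad refl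
    where
    split : ∀ b → b ≡ bad → decide k A₂ A₃ A₅ b f g ≢ 0 → b ≡ 0 × Decision (decide k A₂ A₃ A₅ b f g)
    split (suc _) _ nz = contradiction refl nz
    split zero _ nz = refl , choose
      where
      open-sum = gap (g 2) (f 2 + 1) + (g 2 ∸ k) + gap (f 0) (f 1) + gap (g 0) (g 1)
      choose : Decision (decide k A₂ A₃ A₅ 0 f g)
      choose with gap (g 2) (f 2) ≟ 0
      choose | no j≢ with open-sum ≟ 0
      ... | no ≢0 = contradiction (trans (if0-≢0 j≢) (if0-≢0 ≢0)) nz
      ... | yes ≡0 = opened j≢ (trans (gap≡0 (m+n≡0⇒m≡0 _ ab)) (+-comm (f 2) 1))
                       (m∸n≡0⇒m≤n (m+n≡0⇒n≡0 (gap (g 2) (f 2 + 1)) ab))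
                       (gap≡0 (m+n≡0⇒n≡0 (gap (g 2) (f 2 + 1) + (g 2 ∸ k)) abc))
                       (gap≡0 (m+n≡0⇒n≡0 (gap (g 2) (f 2 + 1) + (g 2 ∸ k) + gap (f 0) (f 1)) ≡0))
                       (trans (if0-≢0 j≢) (if0-≡0 ≡0))
        where
        abc = m+n≡0⇒m≡0 (gap (g 2) (f 2 + 1) + (g 2 ∸ k) + gap (f 0) (f 1)) ≡0
        ab  = m+n≡0⇒m≡0 (gap (g 2) (f 2 + 1) + (g 2 ∸ k)) abc
      choose | yes j≡ with gap (g 1) (f 1) ≟ 0
      ... | no d≢ = contradiction (trans (if0-≡0 j≡) (if0-≢0 d≢)) nz
      ... | yes d≡ with gap (g 0) (f 0) ≟ 0
      ... | yes v≡ = stayed j≡ (gap≡0 d≡) v≡ (trans (if0-≡0 j≡) (trans (if0-≡0 d≡) (if0-≡0 v≡)))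
      ... | no v≢ with f 2 ≟ 0
      ... | yes j≡0 = contradiction (trans (if0-≡0 j≡) (trans (if0-≡0 d≡) (trans (if0-≢0 v≢) (if0-≡0 j≡0)))) nz
      ... | no j≢0 = moved j≡ (gap≡0 d≡) v≢ j≢0
                       (trans (if0-≡0 j≡) (trans (if0-≡0 d≡) (trans (if0-≢0 v≢) (if0-≢0 j≢0))))

open Decisions public

-- What tracing has to know about a step: each bit set afterwards was set before or belongs to the
-- vertex just left by an open vehicle.
Legal : ℕ → (f g : ℕ → ℕ) → Set
Legal n f g = ∀ {u} → u < n → g (3 + u) ≢ 0 → f (3 + u) ≢ 0 ⊎ (u ≡ f 0 × f 2 ≢ 0)

legal⇒ : ∀ {n f g} → (∀ {u} → u < n → g (3 + u) ≤ f (3 + u) ⊎ (u ≡ f 0 × f 2 ≢ 0)) → illegal-gains f g n ≡ 0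
legal⇒ {zero} ok = refl
legal⇒ {suc n} {f} {g} ok with ok (n<1+n n)
... | inj₁ g≤f = trans (if0-≡0 (m≤n⇒m∸n≡0 g≤f)) (legal⇒ {n} (ok ∘ m<n⇒m<1+n))
... | inj₂ (n≡ , j≢0) with g (3 + n) ∸ f (3 + n)
... | zero  = legal⇒ {n} {f} {g} (ok ∘ m<n⇒m<1+n)
... | suc _ = cong₂ _+_ (legal⇒ {n} {f} {g} (ok ∘ m<n⇒m<1+n)) (cong₂ _+_ (gap-≡ n≡) (m≤n⇒m∸n≡0 (n≢0⇒n>0 j≢0)))

legal⇐ : ∀ {n f g} → illegal-gains f g n ≡ 0 → Legal n f g
legal⇐ {suc n} {f} {g} z {u} u<1+n g≢0 with g (3 + n) ∸ f (3 + n) in eq | <-suc-elim u<1+n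
... | zero  | inj₁ u<n  = legal⇐ {n} {f} {g} z u<n g≢0
... | zero  | inj₂ refl = inj₁ λ f≡0 → g≢0 (n≤0⇒n≡0 (≤-trans (m∸n≡0⇒m≤n eq) (≤-reflexive f≡0)))
... | suc _ | inj₁ u<n  = legal⇐ {n} {f} {g} (m+n≡0⇒m≡0 _ z) u<n g≢0
... | suc _ | inj₂ refl = let z′ = m+n≡0⇒n≡0 (illegal-gains f g n) z in
  inj₂ ( gap≡0 (m+n≡0⇒m≡0 _ z′)
       , λ f≡0 → contradiction (trans (cong (1 ∸_) (sym f≡0)) (m+n≡0⇒n≡0 (gap n (f 0)) z′)) λ ())

missing-≡0 : ∀ {A f n} → f 0 ≡ f 1 → (∀ {u} → u < n → A (3 + u) ∸ 1 ≤ f (3 + u)) → missing A f n ≡ 0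
missing-≡0 {n = zero}  p all = gap-≡ p
missing-≡0 {n = suc n} p all = cong₂ _+_ (missing-≡0 {n = n} p (all ∘ m<n⇒m<1+n)) (m≤n⇒m∸n≡0 (all (n<1+n n)))

missing≡0 : ∀ {A f n} → missing A f n ≡ 0 → f 0 ≡ f 1 × (∀ {u} → u < n → A (3 + u) ∸ 1 ≤ f (3 + u))
missing≡0 {n = zero} z = gap≡0 z , λ ()
missing≡0 {A} {f} {suc n} z =
  let p , all = missing≡0 {A} {f} {n} (m+n≡0⇒m≡0 _ z) in
  p , λ u<1+n → [ all , (λ { refl → m∸n≡0⇒m≤n (m+n≡0⇒n≡0 (missing A f n) z) }) ]′ (<-suc-elim u<1+n)

-- Recording the predecessors makes every radix a successor by its form, so divisions by a radix are
-- defined without further proof. A depot exists, so `n` is positive and `pred` loses nothing.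
radix-1 : Instance → ℕ → ℕ
radix-1 I 0 = pred (Instance.n I)
radix-1 I 1 = pred (Instance.n I)
radix-1 I 2 = Instance.n I
radix-1 I (suc (suc (suc u))) = fromList (characteristic (Instance.clients I)) u

-- From routings to paths of no greater weight

module Search (I : Instance) (M : ℕ) (A₃ A₄ A₅ : ℕ → ℕ)
  (m≤M : 3 + Instance.n I ≤ M) (N≤M : capacity (radix-1 I) (3 + Instance.n I) ≤ M)
  (A₃-depot : ∀ {u} → u < Instance.n I → A₃ u ≡ fromList (characteristic (Instance.depots I)) u)
  (A₄-radix : ∀ {i} → i < 3 + Instance.n I → A₄ i ≡ suc (radix-1 I i))
  (A₅-row : ∀ {u} → u < Instance.n I → A₅ u ≡ u * Instance.n I) where

  open Instance I

  ρ : ℕ → ℕ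
  ρ = radix-1 I

  N : ℕ
  N = capacity ρ (3 + n)

  open Tables M n k N (fromList (matrix I)) A₃ A₄ A₅ ρ m≤M N≤M A₄-radix public
  open Shortening N δ goal public

  client : ℕ → ℕ
  client = fromList (characteristic clients)

  Tour : Set
  Tour = Σ[ d ∈ V ] d ∈ depots × Walk d d

  stops : Tour → List V
  stops (_ , _ , p) = vertices p

  tourWeight : Tour → ℕ
  tourWeight (_ , _ , p) = walkWeight p

  entry-at : ∀ u v → fromList (matrix I) (A₅ (toℕ u) + toℕ v) ≡ entry (adj u v) (w u v)
  entry-at u v = trans (cong (λ r → fromList (matrix I) (r + toℕ v)) (A₅-row (toℕ<n u)))
                       (fromList-rows (λ u v → entry (adj u v) (w u v)) u v)

  entry-adj : ∀ {u v} (e : Adj u v) → entry (adj u v) (w u v) ≡ suc (w u v e)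
  entry-adj {u} {v} e = lemma (adj u v) (w u v) e
    where
    lemma : ∀ b (f : T b → ℕ) e → entry b f ≡ suc (f e)
    lemma true f e = refl

  entry-suc : ∀ {u v m} → entry (adj u v) (w u v) ≡ suc m → Σ[ e ∈ Adj u v ] w u v e ≡ m
  entry-suc {u} {v} eq = lemma (adj u v) (w u v) eq
    where
    lemma : ∀ b (f : T b → ℕ) {m} → entry b f ≡ suc m → Σ[ e ∈ T b ] f e ≡ m
    lemma true f eq = _ , suc-injective eq

  Step : (f g : ℕ → ℕ) → ℕ → Set
  Step f g = Decision k (fromList (matrix I)) A₃ A₅ {illegal-gains f g n} {f} {g}

  ψ-step : ∀ f g {v} → illegal-gains f g n ≡ 0 → Step f g v → ψ f g ≡ v
  ψ-step f g legal D = decision k (fromList (matrix I)) A₃ A₅ {f = f} {g} legal D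

  -- `vis` may mark any vertex; masking it with `client` keeps each bit within its radix, which is 1
  -- for a non-client.
  layout : (ℕ → Bool) → (j d v : ℕ) → ℕ → ℕ
  layout vis j d v 0 = v
  layout vis j d v 1 = d
  layout vis j d v 2 = j
  layout vis j d v (suc (suc (suc u))) = if vis u then client u else 0

  layout-valid : ∀ vis {j} (d v : V) → j ≤ n → ∀ {i} → i < 3 + n → layout vis j (toℕ d) (toℕ v) i ≤ ρ i
  layout-valid vis d v j≤n {0} _ = <⇒≤pred (toℕ<n v)
  layout-valid vis d v j≤n {1} _ = <⇒≤pred (toℕ<n d)
  layout-valid vis d v j≤n {2} _ = j≤n
  layout-valid vis d v j≤n {suc (suc (suc u))} _ with vis u
  ... | true  = ≤-refl
  ... | false = z≤n

  Cheap : ℕ → ℕ → Set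
  Cheap s X = ∃[ l ] ∃[ c ] Path s l c × c ≤ X

  -- Quantifying over all codes with the digits `F` allows reasoning with digits alone and accepts
  -- whichever code `encode` returns.
  Reaches : (ℕ → ℕ) → ℕ → Set
  Reaches F X = ∀ {s} → (∀ {i} → i < 3 + n → digit s i ≡ F i) → Cheap s X

  prepend : ∀ {F G w X} → (∀ {i} → i < 3 + n → G i ≤ ρ i) → ψ F G ≡ suc w → Reaches G X → Reaches F (w + X)
  prepend {F} {G} {w} valid eq R s≈F =
    let t , t<N , t≈G = encode ρ (3 + n) G valid
        l , c , p , c≤ = R t≈G
    in suc l , w + c , step t<N (trans (ψ-cong s≈F t≈G) eq) p , +-monoʳ-≤ w c≤

  relaxed : ∀ {F X Y} → X ≤ Y → Reaches F X → Reaches F Y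
  relaxed X≤Y R s≈F = let l , c , p , c≤ = R s≈F in l , c , p , ≤-trans c≤ X≤Y

  mark : ℕ → (ℕ → Bool) → ℕ → Bool
  mark v vis = vis [ v ↦ true ]

  mark-legal : ∀ vis {j d v d′ v′} → j ≢ 0 →
               illegal-gains (layout vis j d v) (layout (mark v vis) j d′ v′) n ≡ 0
  mark-legal vis {j} {d} {v} j≢0 = legal⇒ {n} ok
    where
    ok : ∀ {u} → u < n → (if mark v vis u then client u else 0) ≤ (if vis u then client u else 0) ⊎ (u ≡ v × j ≢ 0)
    ok {u} _ with v ≟ u
    ... | yes refl = inj₂ (refl , j≢0)
    ... | no v≢u   = inj₁ (≤-reflexive (cong (λ b → if b then client u else 0) (update-≢ vis v≢u)))

  mark-same : ∀ v vis → mark v vis v ≡ true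
  mark-same v vis = update-same vis v

  mark-grows : ∀ v vis {u} → vis u ≡ true → mark v vis u ≡ true
  mark-grows v vis {u} eq with v ≟ u
  ... | yes refl = update-same vis v
  ... | no v≢u   = trans (update-≢ vis v≢u) eq

  -- Continuation style: the rest of the path is given for every visited set that extends `vis` and
  -- contains the walk, so the set actually accumulated never has to be named.
  follow : ∀ {v e X} (p : Walk v e) vis {j} (d : V) → j ≢ 0 → j ≤ n →
           (∀ vis′ → (∀ {u} → vis u ≡ true → vis′ u ≡ true) →
                     (∀ {u} → u List.∈ vertices p → vis′ (toℕ u) ≡ true) →
                     Reaches (layout vis′ j (toℕ d) (toℕ e)) X) →
           Reaches (layout vis j (toℕ d) (toℕ v)) (walkWeight p + X)
  -- Bits are set on leaving a vertex, so the last vertex is marked by a stay.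
  follow {v} ε vis {j} d j≢0 j≤n rest =
    prepend (layout-valid (mark (toℕ v) vis) d v j≤n)
      (ψ-step (layout vis j (toℕ d) (toℕ v)) (layout (mark (toℕ v) vis) j (toℕ d) (toℕ v))
        (mark-legal vis j≢0) (stayed (gap-≡ {j} refl) refl (gap-≡ {toℕ v} refl) refl))
      (rest (mark (toℕ v) vis) (mark-grows (toℕ v) vis) λ { (here refl) → mark-same (toℕ v) vis })
  follow {v} {X = X} (_◅_ {v} {v′} e p) vis {j} d j≢0 j≤n rest = enter (toℕ v′ ≟ toℕ v)
    where
    vis⁺ : ℕ → Bool
    vis⁺ = mark (toℕ v) vis
    onward : Reaches (layout vis⁺ j (toℕ d) (toℕ v′)) (walkWeight p + X)
    onward = follow p vis⁺ d j≢0 j≤n λ vis′ grows visited → rest vis′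
      (grows ∘ mark-grows (toℕ v) vis)
      (λ { (here refl) → grows (mark-same (toℕ v) vis) ; (there u∈p) → visited u∈p })
    enter : Dec (toℕ v′ ≡ toℕ v) → Reaches (layout vis j (toℕ d) (toℕ v)) (w v v′ e + walkWeight p + X)
    -- Graphs may have loops, but a step with unchanged vertex is a free stay; a loop is replaced by
    -- it and the weight can only drop.
    enter (yes v′≡v) = relaxed
      (≤-trans (m≤n+m (walkWeight p + X) (w v v′ e)) (≤-reflexive (sym (+-assoc (w v v′ e) _ X))))
      (prepend (layout-valid vis⁺ d v′ j≤n)
        (ψ-step (layout vis j (toℕ d) (toℕ v)) (layout vis⁺ j (toℕ d) (toℕ v′))
          (mark-legal vis j≢0) (stayed (gap-≡ {j} refl) refl (gap-≡ v′≡v) refl)) onward)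
    enter (no v′≢v) = relaxed (≤-reflexive (sym (+-assoc (w v v′ e) _ X)))
      (prepend (layout-valid vis⁺ d v′ j≤n)
        (trans (ψ-step (layout vis j (toℕ d) (toℕ v)) (layout vis⁺ j (toℕ d) (toℕ v′))
          (mark-legal vis j≢0) (moved (gap-≡ {j} refl) refl (v′≢v ∘ gap≡0) j≢0 refl))
          (trans (entry-at v v′) (entry-adj e))) onward)

  -- Induction on the vehicles not yet opened, always at a state with `v = d`. Each client is either
  -- marked already or on a remaining tour; with no tour left this is the goal condition.
  tours : ∀ ts vis {j d} → j + length ts ≤ n → j + length ts ≤ k →
          (∀ c → c ∈ clients → vis (toℕ c) ≡ true ⊎ Any (λ t → c List.∈ stops t) ts) →
          Reaches (layout vis j d d) (sum (map tourWeight ts))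
  tours [] vis {j} {d} _ _ covered {s} s≈F = 0 , 0 , stop goal≡1 , ≤-refl
    where
    visited : ∀ {u} → u < n → A₄ (3 + u) ∸ 1 ≤ layout vis j d d (3 + u)
    visited {u} u<n rewrite A₄-radix (3+ u<n) with client u in eq
    ... | zero = z≤n
    ... | suc _ with covered (fromℕ< u<n) (characteristic-∈⁻ clients (fromℕ< u<n)
                       λ z → contradiction (trans (sym (trans (cong client (toℕ-fromℕ< u<n)) eq)) z) λ ())
    ... | inj₁ yes′ rewrite toℕ-fromℕ< u<n | yes′ = ≤-refl
    goal≡1 : goal s ≡ 1
    goal≡1 = if0-≡0 (trans (missing-cong s≈F ≤-refl) (missing-≡0 refl visited))
  tours ((d′ , d′∈D , p) ∷ ts) vis {j} {d} ≤n ≤k covered =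
    prepend (layout-valid vis d′ d′ 1+j≤n)
      (ψ-step (layout vis j d d) (layout vis (suc j) (toℕ d′) (toℕ d′)) (legal⇒ {n} (λ _ → inj₁ ≤-refl))
        (opened (λ z → 1+n≢n (gap≡0 {suc j} {j} z)) refl 1+j≤k refl refl
          (sym (trans (A₃-depot (toℕ<n d′)) (characteristic-∈ d′∈D)))))
      (follow p vis d′ (λ ()) 1+j≤n λ vis′ grows visited →
        tours ts vis′ (shift ≤n) (shift ≤k) λ c c∈C → cover vis′ grows visited (covered c c∈C))
    where
    shift : ∀ {x} → j + suc (length ts) ≤ x → suc j + length ts ≤ x
    shift = ≤-trans (≤-reflexive (sym (+-suc j _)))
    1+j≤n : suc j ≤ n
    1+j≤n = ≤-trans (m≤m+n (suc j) _) (shift ≤n)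
    1+j≤k : suc j ≤ k
    1+j≤k = ≤-trans (m≤m+n (suc j) _) (shift ≤k)
    cover : ∀ vis′ → (∀ {u} → vis u ≡ true → vis′ u ≡ true) →
            (∀ {u} → u List.∈ vertices p → vis′ (toℕ u) ≡ true) → ∀ {c} →
            vis (toℕ c) ≡ true ⊎ Any (λ t → c List.∈ stops t) ((d′ , d′∈D , p) ∷ ts) →
            vis′ (toℕ c) ≡ true ⊎ Any (λ t → c List.∈ stops t) ts
    cover vis′ grows visited (inj₁ v)         = inj₁ (grows v)
    cover vis′ grows visited (inj₂ (here c∈)) = inj₁ (visited c∈)
    cover vis′ grows visited (inj₂ (there a)) = inj₂ a

  start-digits : ∀ {i} → i < 3 + n → digit 0 i ≡ layout (λ _ → false) 0 0 0 i
  start-digits {i} _ = trans (cong (_% suc (ρ i)) (quo-0 ρ i)) (sym (zeros i))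
    where
    zeros : ∀ i → layout (λ _ → false) 0 0 0 i ≡ 0
    zeros 0 = refl
    zeros 1 = refl
    zeros 2 = refl
    zeros (suc (suc (suc u))) = refl

  routing-path : (R : Routing I) → Cheap 0 (Routing.weight R)
  routing-path R₀ =
    let R , k′≤n , R≤R₀ = few-vehicles R₀
        open Routing R
        tour : Fin k′ → Tour
        tour i = start i , start∈D i , walk i
        len = length-tabulate tour
        l , c , p , c≤ = tours (tabulate tour) (λ _ → false)
          (≤-trans (≤-reflexive len) k′≤n) (≤-trans (≤-reflexive len) k′≤k)
          (λ c c∈C → inj₂ (tabulate⁺ (assign c c∈C) (visits c c∈C))) start-digits
    in l , c , p , ≤-trans c≤ (≤-trans (≤-reflexive (cong sum (map-tabulate tour tourWeight))) R≤R₀)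

  -- A stay that changes nothing has weight 0, so `pad` can lengthen a short path to exactly `N`
  -- steps.
  stay : ∀ s → δ s s ≡ 1
  stay s = ψ-step (digit s) (digit s) (legal⇒ {n} (λ _ → inj₁ ≤-refl))
    (stayed (gap-≡ {digit s 2} refl) refl (gap-≡ {digit s 0} refl) refl)

  N>0 : 0 < N
  N>0 = <-≤-trans z<s (encode ρ (3 + n) (λ _ → 0) (λ _ → z≤n) .proj₂ .proj₁)

  pad : ∀ {s l c} → s < N → ∀ j → Path s l c → Path s (j + l) c
  pad s<N zero    p = p
  pad s<N (suc j) p = step s<N (stay _) (pad s<N j p)

  module _ {A₆ A₇ : ℕ → ℕ} (F : Filled N 0 A₆ A₇) where
    open Filled F

    -- The completeness half of `Best`, applied along the path, shows that no path beats the table.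
    -- The soundness half serves the tracing.
    path-bound : ∀ {s l c} → Path s l c → s < N → l ≤ N → A₆ (l * N + s) ≢ 0 × A₆ (l * N + s) ≤ suc c
    path-bound (stop goal≡1) s<N _ rewrite base s<N | goal≡1 = (λ ()) , ≤-refl
    path-bound {s} (step {t} {w} {l} {c} t<N δ≡ p) s<N l<N =
      let W≢0 , W≤ = path-bound p t<N (<⇒≤ l<N)
          b≢0 , b≤ = Best.complete (previous l<N s<N) t<N (λ z → contradiction (trans (sym δ≡) z) λ ()) W≢0
      in b≢0 , (begin
        A₆ (suc l * N + s)            ≤⟨ b≤ ⟩
        δ s t + A₆ (l * N + t) ∸ 1    ≡⟨ cong (λ x → x + A₆ (l * N + t) ∸ 1) δ≡ ⟩
        w + A₆ (l * N + t)            ≤⟨ +-monoʳ-≤ w W≤ ⟩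
        w + suc c                     ≡⟨ +-suc w c ⟩
        suc (w + c)                   ∎)
      where open ≤-Reasoning

    routing-bound : (R : Routing I) → A₆ (N * N + 0) ≢ 0 × A₆ (N * N + 0) ≤ suc (Routing.weight R)
    routing-bound R =
      let _ , c , p , c≤ = routing-path R
          l , c′ , p′ , l<N , c′≤ = shorten N>0 p
          full = subst (λ l → Path 0 l c′) (m∸n+n≡m (<⇒≤ l<N)) (pad N>0 (N ∸ l) p′)
          ≢0 , ≤c = path-bound full N>0 ≤-refl
      in ≢0 , ≤-trans ≤c (s≤s (≤-trans c′≤ c≤))

-- Following an optimal path

Segment : (ℕ → ℕ) → ℕ → List ℕ → Set
Segment A o []       = ⊤
Segment A o (x ∷ xs) = A o ≡ x × Segment A (suc o) xs

segment-++ : ∀ {A o} xs {ys} → Segment A o xs → Segment A (o + length xs) ys → Segment A o (xs ++ ys)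
segment-++ {A} {o} []       _        t = subst (λ o → Segment A o _) (+-identityʳ o) t
segment-++ {A} {o} (x ∷ xs) {ys} (eq , s) t =
  eq , segment-++ xs s (subst (λ o → Segment A o ys) (+-suc o (length xs)) t)

segment-cong : ∀ {A B o} xs → (∀ {j} → o ≤ j → j < o + length xs → B j ≡ A j) → Segment A o xs → Segment B o xs
segment-cong [] eq _ = tt
segment-cong {o = o} (x ∷ xs) eq (a , s) =
  trans (eq ≤-refl (m<m+n o z<s)) a ,
  segment-cong xs (λ o<j j< → eq (<⇒≤ o<j) (<-≤-trans j< (≤-reflexive (sym (+-suc o (length xs)))))) s

segment-update≥ : ∀ {A o i v} xs → o + length xs ≤ i → Segment A o xs → Segment (A [ i ↦ v ]) o xs
segment-update≥ {A} xs after = segment-cong xs λ _ j< → update-≢ A (>⇒≢ (<-≤-trans j< after))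

segment-lookup : ∀ {A o} xs → Segment A o xs → ∀ i → A (o + toℕ i) ≡ lookup xs i
segment-lookup {A} {o} (x ∷ xs) (eq , s) zero    = trans (cong A (+-identityʳ o)) eq
segment-lookup {A} {o} (x ∷ xs) (eq , s) (suc i) = trans (cong A (+-suc o (toℕ i))) (segment-lookup xs s i)

-- Indices come from array cells and carry no bound. The empty default makes membership in
-- `nth xss i` a proof that `i` is in range, which `nth-map` extracts.
nth : ∀ {A : Set} → List (List A) → ℕ → List A
nth []         i       = []
nth (xs ∷ xss) zero    = xs
nth (xs ∷ xss) (suc i) = nth xss i

nth-last : ∀ {A : Set} (xss : List (List A)) {ys} → nth (xss ++ [ ys ]) (length xss) ≡ ys
nth-last []         = refl
nth-last (xs ∷ xss) = nth-last xss

nth-mono : ∀ {A : Set} (xss : List (List A)) {ys zs c} → (c List.∈ ys → c List.∈ zs) →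
           ∀ i → c List.∈ nth (xss ++ [ ys ]) i → c List.∈ nth (xss ++ [ zs ]) i
nth-mono []         f zero    c∈ = f c∈
nth-mono (xs ∷ xss) f zero    c∈ = c∈
nth-mono (xs ∷ xss) f (suc i) c∈ = nth-mono xss f i c∈

nth-++ : ∀ {A : Set} (xss : List (List A)) {yss c} i → c List.∈ nth xss i → c List.∈ nth (xss ++ yss) i
nth-++ (xs ∷ xss) zero    c∈ = c∈
nth-++ (xs ∷ xss) (suc i) c∈ = nth-++ xss i c∈

nth-map : ∀ {A B : Set} (f : A → List B) xs {c} i → c List.∈ nth (map f xs) i →
          Σ[ j ∈ Fin (length xs) ] toℕ j ≡ i × c List.∈ f (lookup xs j)
nth-map f (x ∷ xs) zero    c∈ = zero , refl , c∈
nth-map f (x ∷ xs) (suc i) c∈ = let j , eq , c∈′ = nth-map f xs i c∈ in suc j , cong suc eq , c∈′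

module Walks {G : Graph} (W : EdgeWeights G) where
  open Graph G
  open EdgeWeights W

  end∈vertices : ∀ {u v} (p : Walk u v) → v List.∈ vertices p
  end∈vertices ε       = here refl
  end∈vertices (_ ◅ p) = there (end∈vertices p)

  vertices-snoc : ∀ {u v x} (p : Walk u v) (e : Adj v x) → vertices (p ◅◅ e ◅ ε) ≡ vertices p ++ [ x ]
  vertices-snoc ε       e = refl
  vertices-snoc (f ◅ p) e = cong (_ ∷_) (vertices-snoc p e)

  walkWeight-snoc : ∀ {u v x} (p : Walk u v) (e : Adj v x) →
                    walkWeight (p ◅◅ e ◅ ε) ≡ walkWeight p + w v x e
  walkWeight-snoc {v = v} {x} ε e = +-identityʳ (w v x e)
  walkWeight-snoc {v = v} {x} (f ◅ p) e = trans (cong (w _ _ f +_) (walkWeight-snoc p e)) (sym (+-assoc (w _ _ f) _ _))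

module Tracing (I : Instance) (M : ℕ) (A₃ A₄ A₅ : ℕ → ℕ)
  (m≤M : 3 + Instance.n I ≤ M) (N≤M : capacity (radix-1 I) (3 + Instance.n I) ≤ M)
  (A₃-depot : ∀ {u} → u < Instance.n I → A₃ u ≡ fromList (characteristic (Instance.depots I)) u)
  (A₄-radix : ∀ {i} → i < 3 + Instance.n I → A₄ i ≡ suc (radix-1 I i))
  (A₅-row : ∀ {u} → u < Instance.n I → A₅ u ≡ u * Instance.n I) where

  open Instance I
  open Search I M A₃ A₄ A₅ m≤M N≤M A₃-depot A₄-radix A₅-row
  open Timed M
  open Walks weights

  code : List V → List ℕ
  code vs = length vs ∷ map toℕ vs

  codes : List (List V) → List ℕ
  codes vss = concat (map code vss)

  codes-snoc : ∀ vss vs → codes (vss ++ [ vs ]) ≡ codes vss ++ code vs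
  codes-snoc vss vs = trans (cong concat (map-++ code vss [ vs ]))
    (trans (sym (concat-++ (map code vss) [ code vs ])) (cong (codes vss ++_) (++-identityʳ (code vs))))

  Served : (b : ℕ → ℕ) → List (List V) → (ℕ → ℕ) → Set
  Served b vss A₁ = ∀ (c : V) → b (3 + toℕ c) ≢ 0 → c List.∈ nth vss (A₁ (toℕ c))

  -- b supplies the visited bits and f the other digits: while a transition is
  -- traced, the bits are already those of the new state.
  record Finished (f b A₀ A₁ : ℕ → ℕ) (pos spent : ℕ) : Set where
    field
      done   : List Tour
      count  : f 2 ≡ length done
      count≤ : length done ≤ k
      text   : Segment A₀ 0 (codes (map stops done))
      pos=   : pos ≡ length (codes (map stops done))
      spent= : spent ≡ sum (map tourWeight done)
      served : Served b (map stops done) A₁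

  record Running (f b A₀ A₁ : ℕ → ℕ) (pos head spent : ℕ) : Set where
    field
      done   : List Tour
      {d v}  : V
      d∈D    : d ∈ depots
      p      : Walk d v
      d=     : f 1 ≡ toℕ d
      v=     : f 0 ≡ toℕ v
      count  : f 2 ≡ suc (length done)
      count≤ : f 2 ≤ k
      text   : Segment A₀ 0 (codes (map stops done))
      head=  : head ≡ length (codes (map stops done))
      header : A₀ head ≡ length (vertices p)
      body   : Segment A₀ (suc head) (map toℕ (vertices p))
      pos=   : pos ≡ suc head + length (vertices p)
      spent= : spent ≡ sum (map tourWeight done) + walkWeight p
      served : Served b (map stops done ++ [ vertices p ]) A₁

  data Partial (f b A₀ A₁ : ℕ → ℕ) (pos head spent : ℕ) : Set where
    idle   : f 2 ≡ 0 → f 0 ≡ f 1 → Finished f b A₀ A₁ pos spent → Partial f b A₀ A₁ pos head spent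
    active : Running f b A₀ A₁ pos head spent → Partial f b A₀ A₁ pos head spent

  module _ {f g A₀ A₁ : ℕ → ℕ} {pos head spent : ℕ} (f=g : ∀ {i} → i < 3 + n → f i ≡ g i) where

    served-cong : ∀ vss → Served f vss A₁ → Served g vss A₁
    served-cong vss S c g≢0 = S c λ f≡0 → g≢0 (trans (sym (f=g (3+ (toℕ<n c)))) f≡0)

    partial-cong : Partial f f A₀ A₁ pos head spent → Partial g g A₀ A₁ pos head spent
    partial-cong (idle j≡0 v≡d F) = idle (trans (sym (f=g 2<)) j≡0)
      (trans (sym (f=g 0<)) (trans v≡d (f=g 1<)))
      record { Finished F hiding (count; served); count = trans (sym (f=g 2<)) (Finished.count F)
             ; served = served-cong (map stops (Finished.done F)) (Finished.served F) }
    partial-cong (active R) = active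
      record { Running R hiding (d=; v=; count; count≤; served)
             ; d= = trans (sym (f=g 1<)) (Running.d= R) ; v= = trans (sym (f=g 0<)) (Running.v= R)
             ; count = trans (sym (f=g 2<)) (Running.count R)
             ; count≤ = ≤-trans (≤-reflexive (sym (f=g 2<))) (Running.count≤ R)
             ; served = served-cong (map stops (Running.done R) ++ [ vertices (Running.p R) ]) (Running.served R) }

  module _ {f g A₀ A₁ : ℕ → ℕ} {pos head spent : ℕ} (legal : Legal n f g) where

    -- Every step overwrites the assignment of the vertex it leaves, whether or not a bit is gained.
    -- This is harmless: the current walk ends at that vertex, so the current vehicle, with index
    -- `f 2 ∸ 1`, serves it as well. Before the first opening no bit is set, and there is nothing to
    -- serve.
    gain : Partial f f A₀ A₁ pos head spent → Partial f g A₀ (A₁ [ f 0 ↦ f 2 ∸ 1 ]) pos head spent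
    gain (idle j≡0 v≡d F) = idle j≡0 v≡d
      record { Finished F hiding (served)
             ; served = λ c g≢0 → contradiction (legal (toℕ<n c) g≢0) [ none c , (λ (_ , j≢0) → j≢0 j≡0) ]′ }
      where
      open Finished F
      empty : ∀ ts → 0 ≡ length ts → ∀ {c i} → ¬ (c List.∈ nth (map stops ts) i)
      empty [] _ ()
      none : ∀ c → f (3 + toℕ c) ≢ 0 → _
      none c f≢0 = empty done (trans (sym j≡0) count) (served c f≢0)
    gain (active R) = active record { Running R hiding (served); served = served′ }
      where
      open Running R
      served′ : Served g (map stops done ++ [ vertices p ]) (A₁ [ f 0 ↦ f 2 ∸ 1 ])
      served′ c g≢0 with f 0 ≟ toℕ c
      ... | yes f0≡c = subst (λ i → c List.∈ nth (map stops done ++ [ vertices p ]) i)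
        (sym (trans (cong (A₁ [ f 0 ↦ f 2 ∸ 1 ]) (sym f0≡c))
               (trans (update-same A₁ (f 0)) (trans (cong (_∸ 1) count) (sym (length-map stops done))))))
        (subst (c List.∈_) (sym (nth-last (map stops done)))
          (subst (List._∈ vertices p) (toℕ-injective (trans (sym v=) f0≡c)) (end∈vertices p)))
      ... | no f0≢c = subst (λ i → c List.∈ nth (map stops done ++ [ vertices p ]) i) (sym (update-≢ A₁ f0≢c))
        ([ served c , (λ (c≡f0 , _) → contradiction (sym c≡f0) f0≢c) ]′ (legal (toℕ<n c) g≢0))

  -- With `v = d` the open walk is closed, hence a tour. Its header and body lie directly behind the
  -- finished codes, so the text grows by concatenation alone.
  finish : ∀ {f b A₀ A₁ pos head spent} → f 0 ≡ f 1 → Partial f b A₀ A₁ pos head spent → Finished f b A₀ A₁ pos spent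
  finish v≡d (idle _ _ F) = F
  finish {f} {b} {A₀} {A₁} {pos} {head} {spent} v≡d (active R) =
    close R (toℕ-injective (trans (sym (Running.v= R)) (trans v≡d (Running.d= R))))
    where
    close : (R : Running f b A₀ A₁ pos head spent) → Running.v R ≡ Running.d R → Finished f b A₀ A₁ pos spent
    close record { done = done ; d = d ; v = .d ; d∈D = d∈D ; p = p ; count = count ; count≤ = count≤
                 ; text = text ; head= = refl ; header = header ; body = body ; pos= = pos=
                 ; spent= = spent= ; served = served } refl = record
      { done = done ++ [ t ]
      ; count = trans count len
      ; count≤ = ≤-trans (≤-reflexive (trans (sym len) (sym count))) count≤
      ; text = subst (Segment A₀ 0) codes= (segment-++ (codes (map stops done)) text (header , body))
      ; pos= = trans pos= (trans (sym (+-suc _ _)) (trans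
          (cong (λ l → length (codes (map stops done)) + suc l) (sym (length-map toℕ (vertices p))))
          (trans (sym (length-++ (codes (map stops done)))) (cong length codes=))))
      ; spent= = trans spent= (sym (trans (cong sum (map-++ tourWeight done [ t ]))
          (trans (sum-++ (map tourWeight done) _) (cong (sum (map tourWeight done) +_) (+-identityʳ _)))))
      ; served = λ c b≢0 → subst (λ vss → c List.∈ nth vss _) (sym (map-++ stops done [ t ])) (served c b≢0)
      }
      where
      t : Tour
      t = d , d∈D , p
      len : suc (length done) ≡ length (done ++ [ t ])
      len = trans (+-comm 1 (length done)) (sym (length-++ done))
      codes= : codes (map stops done) ++ code (vertices p) ≡ codes (map stops (done ++ [ t ]))
      codes= = trans (sym (codes-snoc (map stops done) (vertices p))) (cong codes (sym (map-++ stops done [ t ])))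

  module _ {f g A₀ A₁ : ℕ → ℕ} {pos spent : ℕ} where

    open-tour : (F : Finished f g A₀ A₁ pos spent) → g 2 ≡ suc (f 2) → g 2 ≤ k → g 0 ≡ g 1 →
                g 0 < n → A₃ (g 0) ≢ 0 →
                Running g g (A₀ [ pos ↦ 1 ] [ suc pos ↦ g 0 ]) A₁ (2 + pos) pos (spent + 0)
    open-tour F j≡ j≤k v≡d v<n depot = record
      { done = done
      ; d∈D = characteristic-∈⁻ depots u λ z →
          depot (trans (A₃-depot v<n) (trans (cong (fromList (characteristic depots)) (sym u=)) z))
      ; p = ε ; d= = trans (sym v≡d) (sym u=) ; v= = sym u=
      ; count = trans j≡ (cong suc count) ; count≤ = j≤k
      ; text = segment-update≥ _ (≤-trans (≤-reflexive (sym pos=)) (n≤1+n pos))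
          (segment-update≥ _ (≤-reflexive (sym pos=)) text)
      ; head= = pos=
      ; header = trans (update-≢ (A₀ [ pos ↦ 1 ]) {suc pos} 1+n≢n) (update-same A₀ pos)
      ; body = trans (update-same (A₀ [ pos ↦ 1 ]) (suc pos)) (sym u=) , tt
      ; pos= = cong suc (+-comm 1 pos)
      ; spent= = cong (_+ 0) spent=
      ; served = λ c g≢0 → nth-++ (map stops done) _ (served c g≢0)
      }
      where
      open Finished F
      u : V
      u = fromℕ< v<n
      u= : toℕ u ≡ g 0
      u= = toℕ-fromℕ< v<n

    extend-tour : ∀ {head x} (R : Running f g A₀ A₁ pos head spent) → g 2 ≡ f 2 → g 1 ≡ f 1 → g 0 < n →
                  fromList (matrix I) (A₅ (f 0) + g 0) ≡ suc x →
                  Running g g (A₀ [ head ↦ suc (A₀ head) ] [ pos ↦ g 0 ]) A₁ (suc pos) head (spent + x)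
    extend-tour {head} {x} R j≡ d≡ v<n entry≡ =
      let e , we = entry-suc (trans (sym (entry-at v u))
                     (trans (cong₂ (λ a b → fromList (matrix I) (A₅ a + b)) (sym v=) u=) entry≡)) in record
      { done = done ; d∈D = d∈D ; p = p ◅◅ e ◅ ε
      ; d= = trans d≡ d= ; v= = sym u=
      ; count = trans j≡ count ; count≤ = ≤-trans (≤-reflexive j≡) count≤
      ; text = segment-update≥ _ (≤-trans (≤-reflexive (sym head=)) (<⇒≤ head<pos))
          (segment-update≥ _ (≤-reflexive (sym head=)) text)
      ; head= = head=
      ; header = trans (update-≢ (A₀ [ head ↦ suc (A₀ head) ]) (>⇒≢ head<pos)) (trans (update-same A₀ head)
          (trans (cong suc header) (sym (length-snoc e))))
      ; body = subst (Segment _ (suc head))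
          (sym (trans (cong (map toℕ) (vertices-snoc p e)) (map-++ toℕ (vertices p) [ u ])))
          (segment-++ (map toℕ (vertices p))
            (segment-update≥ _ (≤-reflexive (sym end))
              (segment-cong (map toℕ (vertices p)) (λ head<j _ → update-≢ A₀ (<⇒≢ head<j)) body))
            (trans (cong (A₀ [ head ↦ suc (A₀ head) ] [ pos ↦ g 0 ]) (sym end))
               (trans (update-same (A₀ [ head ↦ suc (A₀ head) ]) pos) (sym u=)) , tt))
      ; pos= = trans (cong suc pos=) (trans (sym (+-suc (suc head) _)) (cong (suc head +_) (sym (length-snoc e))))
      ; spent= = trans (cong₂ _+_ spent= (sym we)) (trans (+-assoc (sum (map tourWeight done)) _ _)
          (cong (sum (map tourWeight done) +_) (sym (walkWeight-snoc p e))))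
      ; served = λ c g≢0 → nth-mono (map stops done)
          (λ c∈ → subst (c List.∈_) (sym (vertices-snoc p e)) (∈-++⁺ˡ c∈)) _ (served c g≢0)
      }
      where
      open Running R
      u : V
      u = fromℕ< v<n
      u= : toℕ u ≡ g 0
      u= = toℕ-fromℕ< v<n
      head<pos : head < pos
      head<pos = ≤-trans (m≤m+n (suc head) _) (≤-reflexive (sym pos=))
      end : pos ≡ suc head + length (map toℕ (vertices p))
      end = trans pos= (cong (suc head +_) (sym (length-map toℕ (vertices p))))
      length-snoc : ∀ e → length (vertices (p ◅◅ e ◅ ε)) ≡ suc (length (vertices p))
      length-snoc e = trans (cong length (vertices-snoc p e)) (trans (length-++ (vertices p)) (+-comm _ 1))

  stay-put : ∀ {f g A₀ A₁ pos head spent} → g 2 ≡ f 2 → g 1 ≡ f 1 → g 0 ≡ f 0 →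
             Partial f g A₀ A₁ pos head spent → Partial g g A₀ A₁ pos head (spent + 0)
  stay-put {spent = spent} j≡ d≡ v≡ (idle j≡0 v≡d F) = idle (trans j≡ j≡0) (trans v≡ (trans v≡d (sym d≡)))
    record { Finished F hiding (count; spent=); count = trans j≡ (Finished.count F)
           ; spent= = trans (+-identityʳ spent) (Finished.spent= F) }
  stay-put {spent = spent} j≡ d≡ v≡ (active R) = active
    record { Running R hiding (count; count≤; d=; v=; spent=); count = trans j≡ (Running.count R)
           ; count≤ = ≤-trans (≤-reflexive j≡) (Running.count≤ R)
           ; d= = trans d≡ (Running.d= R) ; v= = trans v≡ (Running.v= R)
           ; spent= = trans (+-identityʳ spent) (Running.spent= R) }

  run-emit : ∀ {σ spent x} → arrays σ 9 0 < n → ψ (arrays σ 8) (arrays σ 9) ≡ suc x →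
             Partial (arrays σ 8) (arrays σ 8) (arrays σ 0) (arrays σ 1) (regs σ rpos) (regs σ rhead) spent →
             Run emit σ (λ σ′ → Partial (arrays σ 9) (arrays σ 9) (arrays σ′ 0) (arrays σ′ 1)
                                        (regs σ′ rpos) (regs σ′ rhead) (spent + x))
  run-emit {σ} {spent} {x} v<n ψ≡ P = run-⨾ (run-store
    (run-cond
      (λ j≢ → run-⨾ (run-≔ (run-⨾ (run-store (run-⨾ (run-store (run-≔ (opening′ j≢ D))))))))
      (λ j≡ → run-cond
        (λ v≢ → run-⨾ (run-store (run-⨾ (run-store (run-≔ (moving′ j≡ v≢ D P′))))))
        (λ v≡ → run-skip (staying j≡ v≡ D)))))
    where
    f = arrays σ 8
    g = arrays σ 9
    B₁ = arrays σ 1 [ f 0 ↦ f 2 ∸ 1 ]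
    decided = decision⁻ k (fromList (matrix I)) A₃ A₅ {f = f} {g} ψ≡ λ ()
    D : Step f g (suc x)
    D = proj₂ decided
    P′ : Partial f g (arrays σ 0) B₁ (regs σ rpos) (regs σ rhead) spent
    P′ = gain (legal⇐ {n} (proj₁ decided)) P
    A₃≤1 : A₃ (g 0) ≤ 1
    A₃≤1 = ≤-trans (≤-reflexive (A₃-depot v<n)) (characteristic-≤1 depots (g 0))
    opening′ : gap (g 2) (f 2) ≢ 0 → Step f g (suc x) →
               Partial g g (arrays σ 0 [ regs σ rpos ↦ 1 ] [ suc (regs σ rpos) ↦ g 0 ]) B₁
                       (2 + regs σ rpos) (regs σ rpos) (spent + x)
    opening′ j≢ (opened _ j≡ j≤k v≡d v′≡d′ x≡) = active (subst
      (λ x → Running g g (arrays σ 0 [ regs σ rpos ↦ 1 ] [ suc (regs σ rpos) ↦ g 0 ]) B₁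
                     (2 + regs σ rpos) (regs σ rpos) (spent + x))
      -- Here `suc x` is a depot bit and thus at most 1, so opening a vehicle adds weight 0.
      (sym (n≤0⇒n≡0 (s≤s⁻¹ (≤-trans (≤-reflexive x≡) A₃≤1))))
      (open-tour (finish v≡d P′) j≡ j≤k v′≡d′ v<n λ z → contradiction (trans x≡ z) λ ()))
    opening′ j≢ (moved j≡ _ _ _ _)  = contradiction j≡ j≢
    opening′ j≢ (stayed j≡ _ _ _)   = contradiction j≡ j≢
    moving′ : gap (g 2) (f 2) ≡ 0 → gap (g 0) (f 0) ≢ 0 → Step f g (suc x) →
              Partial f g (arrays σ 0) B₁ (regs σ rpos) (regs σ rhead) spent →
              Partial g g (arrays σ 0 [ regs σ rhead ↦ suc (arrays σ 0 (regs σ rhead)) ] [ regs σ rpos ↦ g 0 ]) B₁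
                      (suc (regs σ rpos)) (regs σ rhead) (spent + x)
    moving′ j≡ v≢ (opened j≢ _ _ _ _ _) _ = contradiction j≡ j≢
    moving′ j≡ v≢ (stayed _ _ v≡ _)     _ = contradiction v≡ v≢
    moving′ j≡ v≢ (moved _ d≡ _ j≢0 x≡) (idle j≡0 _ _) = contradiction j≡0 j≢0
    moving′ j≡ v≢ (moved _ d≡ _ j≢0 x≡) (active R) = active (extend-tour R (gap≡0 j≡) d≡ v<n (sym x≡))
    staying : gap (g 2) (f 2) ≡ 0 → gap (g 0) (f 0) ≡ 0 → Step f g (suc x) →
              Partial g g (arrays σ 0) B₁ (regs σ rpos) (regs σ rhead) (spent + x)
    staying j≡ v≡ (opened j≢ _ _ _ _ _) = contradiction j≡ j≢
    staying j≡ v≡ (moved _ _ v≢ _ _)    = contradiction v≡ v≢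
    staying j≡ v≡ (stayed _ d≡ _ x≡)    = subst
      (λ x → Partial g g (arrays σ 0) B₁ (regs σ rpos) (regs σ rhead) (spent + x)) (sym (suc-injective x≡))
      (stay-put (gap≡0 j≡) d≡ (gap≡0 v≡) P′)

  n>0 : 0 < n
  n>0 = ≤-trans z<s (toℕ<n (proj₁ depots-nonempty))

  digit-vertex : ∀ s → digit s 0 < n
  digit-vertex s = <-≤-trans (m%n<n s (suc (pred n))) (≤-reflexive (suc-pred n))
    where instance _ = >-nonZero n>0

  module _ {A₆ A₇ : ℕ → ℕ} (F : Filled N 0 A₆ A₇) where

    -- With `l` steps left, the weight already spent plus the shifted value of the remaining path
    -- stays equal to the shifted optimum.
    record Traced (i off s : ℕ) (A₀ A₁ : ℕ → ℕ) (pos head : ℕ) : Set where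
      constructor traced
      field
        l spent : ℕ
        rounds  : l + i ≡ N
        off=    : off ≡ l * N
        s<N     : s < N
        finite  : A₆ (l * N + s) ≢ 0
        total   : spent + A₆ (l * N + s) ≡ A₆ (N * N + 0)
        partial : Partial (digit s) (digit s) A₀ A₁ pos head spent

    Traced′ : ℕ → State → Set
    Traced′ i σ = Traced i (regs σ roff) (regs σ rs) (arrays σ 0) (arrays σ 1) (regs σ rpos) (regs σ rhead)

    run-traceStep : ∀ {σ i} → Ready σ → arrays σ 7 ≡ A₇ → i < N → Traced′ i σ →
                    Run traceStep σ (Traced′ (suc i))
    run-traceStep {σ} {i} ready A₇= i<N (traced zero spent rounds off= s<N finite total partial) =
      contradiction (≤-reflexive (sym rounds)) (<⇒≱ i<N)
    run-traceStep {σ} {i} ready A₇= i<N (traced (suc l) spent rounds off= s<N finite total partial) =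
      -- A finite entry is attained by its stored choice, so the next state is reachable and its
      -- entry is finite again.
      let t<N , δ≢0 , W≢0 , b≡ = Best.sound (Filled.previous F l<N s<N) finite
          x , δ≡ = positive δ≢0
      in run-⨾ (run-≔ (
        run-decode 0 rs ready₀ (≤-trans (<⇒≤ s<N) N≤M) refl then λ {σ₁} κ₁ digits₁ →
        let ready₁ = still ready₀ κ₁ in
        run-decode 1 rt ready₁ (≤-trans (<⇒≤ t<N) N≤M) (trans (reg= κ₁ rt _) t=) then λ {σ₂} κ₂ digits₂ →
        let ready₂ = still ready₁ κ₂
            digits₁′ : ∀ {i} → i < 3 + n → arrays σ₂ 8 i ≡ digit s i
            digits₁′ = λ i< → trans (cong (λ A → A _) (array= κ₂ 8 _)) (digits₁ i<)
            rs= = trans (reg= κ₂ rs _) (reg= κ₁ rs _)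
            partial₂ : Partial (arrays σ₂ 8) (arrays σ₂ 8) (arrays σ₂ 0) (arrays σ₂ 1)
                               (regs σ₂ rpos) (regs σ₂ rhead) spent
            partial₂ = partial-cong (λ i< → sym (digits₁′ i<))
              (relocate (trans (array= κ₂ 0 _) (array= κ₁ 0 _)) (trans (array= κ₂ 1 _) (array= κ₁ 1 _))
                (trans (reg= κ₂ rpos _) (reg= κ₁ rpos _)) (trans (reg= κ₂ rhead _) (reg= κ₁ rhead _)) partial)
        in run-emit {spent = spent} {x} (≤-trans (s≤s (≤-reflexive (digits₂ 0<))) (digit-vertex t))
             (trans (ψ-cong digits₁′ digits₂) δ≡) partial₂ then λ {σ₃} κ₃ P →
        let rt= = trans (reg= κ₃ rt _) (trans (reg= κ₂ rt _) (trans (reg= κ₁ rt _) t=)) in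
        run-⨾ (run-≔ (run-≔ (subst
          (λ t → Traced (suc i) (regs σ₃ roff ∸ regs σ₃ rN) t (arrays σ₃ 0) (arrays σ₃ 1) (regs σ₃ rpos) (regs σ₃ rhead))
          (sym rt=)
          (traced l (spent + x) (trans (+-suc l i) rounds)
            (trans (cong₂ _∸_ (trans (reg= κ₃ roff _) (trans (reg= κ₂ roff _) (trans (reg= κ₁ roff _) off=)))
                              (N= (still ready₂ κ₃)))
                   (m+n∸m≡n N (l * N)))
            t<N W≢0
            (begin
              spent + x + A₆ (l * N + t)               ≡⟨ +-assoc spent x _ ⟩
              spent + (x + A₆ (l * N + t))             ≡⟨ cong (λ y → spent + (y + A₆ (l * N + t) ∸ 1)) δ≡ ⟨
              spent + (δ s t + A₆ (l * N + t) ∸ 1)     ≡⟨ cong (spent +_) b≡ ⟨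
              spent + A₆ (suc l * N + s)               ≡⟨ total ⟩
              A₆ (N * N + 0)                           ∎)
            (partial-cong digits₂ P)))))))
      where
      open ≡-Reasoning
      s = regs σ rs
      t = A₇ (N + l * N + s)
      ready₀ : Ready (setReg rt (arrays σ 7 (regs σ roff + s)) σ)
      ready₀ = ready
      t= : arrays σ 7 (regs σ roff + s) ≡ t
      t= = cong₂ (λ A o → A (o + s)) A₇= off=
      l<N : l < N
      l<N = ≤-trans (m≤m+n (suc l) i) (≤-reflexive rounds)
      positive : ∀ {y} → y ≢ 0 → ∃[ x ] y ≡ suc x
      positive {zero}  nz = contradiction refl nz
      positive {suc x} _  = x , refl
      relocate : ∀ {f A₀ A₁ A₀′ A₁′ pos head pos′ head′ spent} → A₀′ ≡ A₀ → A₁′ ≡ A₁ → pos′ ≡ pos → head′ ≡ head →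
                 Partial f f A₀ A₁ pos head spent → Partial f f A₀′ A₁′ pos′ head′ spent
      relocate refl refl refl refl P = P

    goal-digits : ∀ {s} → s < N → A₆ s ≢ 0 →
                  A₆ s ≡ 1 × digit s 0 ≡ digit s 1 × (∀ c → c ∈ clients → digit s (3 + toℕ c) ≢ 0)
    goal-digits {s} s<N nz with missing A₄ (digit s) n ≟ 0
    ... | no ≢0 = contradiction (trans (Filled.base F s<N) (if0-≢0 ≢0)) nz
    ... | yes ≡0 = let v≡d , visited = missing≡0 {A₄} {digit s} {n} ≡0 in
      trans (Filled.base F s<N) (if0-≡0 ≡0) , v≡d , λ c c∈C unvisited →
        contradiction (≤-trans (≤-reflexive (trans (sym (characteristic-∈ c∈C))
                                               (sym (cong (_∸ 1) (A₄-radix (3+ (toℕ<n c)))))))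
                        (≤-trans (visited (toℕ<n c)) (≤-reflexive unvisited))) λ ()

  module _ {f b A₀ A₁ : ℕ → ℕ} {pos spent : ℕ} (F : Finished f b A₀ A₁ pos spent)
           (visited : ∀ c → c ∈ clients → b (3 + toℕ c) ≢ 0) where
    open Finished F

    private
      server : ∀ c → c ∈ clients → Σ[ i ∈ Fin (length done) ] toℕ i ≡ A₁ (toℕ c) × c List.∈ stops (lookup done i)
      server c c∈C = nth-map stops done _ (served c (visited c c∈C))

    extracted : Routing I
    extracted = record
      { k′      = length done
      ; k′≤k    = count≤
      ; start   = λ i → lookup done i .proj₁
      ; start∈D = λ i → lookup done i .proj₂ .proj₁
      ; walk    = λ i → lookup done i .proj₂ .proj₂
      ; assign  = λ c c∈C → server c c∈C .proj₁
      ; visits  = λ c c∈C → server c c∈C .proj₂ .proj₂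
      }

    map-done : ∀ {A : Set} (h : Tour → A) → map h done ≡ tabulate (λ i → h (lookup done i))
    map-done h = trans (cong (map h) (sym (tabulate-lookup done))) (map-tabulate (lookup done) h)

    extracted-weight : Routing.weight extracted ≡ spent
    extracted-weight = sym (trans spent= (cong sum (map-done tourWeight)))

    extracted-walks : Segment A₀ 0 (walkList extracted)
    extracted-walks = subst (Segment A₀ 0) (cong concat (trans (cong (map code) (map-done stops))
      (map-tabulate (λ i → stops (lookup done i)) code))) text

    extracted-describes : ∀ {σ} → regs σ 1 ≡ f 2 → arrays σ 0 ≡ A₀ → arrays σ 1 ≡ A₁ → Describes extracted σ
    extracted-describes k= refl refl = record
      { k′-in-reg       = trans k= count
      ; walks-in-array  = segment-lookup (walkList extracted) extracted-walks
      ; assign-in-array = λ c c∈C → sym (server c c∈C .proj₂ .proj₁)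
      }

  run-output : ∀ {σ} → Ready σ → regs σ roff ≡ N * N → Filled N 0 (arrays σ 6) (arrays σ 7) →
               Run output σ (IsAnswer I)
  run-output {σ} ready off= F = run-⨾ (run-≔ (run-cond
    (λ feasible → run-⨾ (run-≔ (run-⨾ (run-≔
      (run-for (Traced′ F) N≤M (N= ready)
        (traced N 0 (+-identityʳ N) off= N>0 (feasible ∘ trans (cong (λ o → arrays σ 6 (o + 0)) off=)) refl
          (partial-cong (λ i< → sym (start-digits i<)) nothing))
        (λ κ i<N _ → run-traceStep F (still ready′ κ) (array= κ 7 _) i<N)
      then λ {σ₁} κ₁ → answer (still ready′ κ₁))))))
    λ infeasible → run-≔ (inj₂ (refl , λ R → proj₁ (routing-bound F R)
      (trans (cong (λ o → arrays σ 6 (o + 0)) (sym off=)) infeasible)))))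
    where
    ready′ : Ready (setReg rhead 0 (setReg rpos 0 (setReg rs 0 σ)))
    ready′ = ready
    nothing : Partial (layout (λ _ → false) 0 0 0) (layout (λ _ → false) 0 0 0) (arrays σ 0) (arrays σ 1) 0 0 0
    nothing = idle refl refl record
      { done = [] ; count = refl ; count≤ = z≤n ; text = tt ; pos= = refl ; spent= = refl
      ; served = λ c b≢0 → contradiction refl b≢0 }
    answer : ∀ {σ₁} → Ready σ₁ → Traced′ F N σ₁ →
             Run (decode 0 rs ⨾ (rk ≔ old 2) ⨾ (rn ≔ lit 1)) σ₁ (IsAnswer I)
    answer ready₁ (traced (suc l) _ rounds _ _ _ _ _) =
      contradiction (≤-reflexive rounds) (<⇒≱ (s≤s (m≤n+m N l)))
    answer {σ₁} ready₁ (traced zero spent _ off= s<N finite total partial) =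
      run-decode 0 rs ready₁ (≤-trans (<⇒≤ s<N) N≤M) refl then λ {σ₂} κ digits →
      let A₆≡1 , v≡d , visited = goal-digits F s<N finite
          fin = finish v≡d partial
          R = extracted fin visited
      in run-⨾ (run-≔ (run-≔ (inj₁
        ( refl
        , R
        -- The added 1 is the shifted cost 0 of the goal state in which the trace ends.
        , (λ R′ → s≤s⁻¹ (begin
            suc (Routing.weight R)              ≡⟨ cong suc (extracted-weight fin visited) ⟩
            suc spent                           ≡⟨ +-comm 1 spent ⟩
            spent + 1                           ≡⟨ cong (spent +_) A₆≡1 ⟨
            spent + arrays σ 6 (regs σ₁ rs)     ≡⟨ total ⟩
            arrays σ 6 (N * N + 0)              ≤⟨ proj₂ (routing-bound F R′) ⟩
            suc (Routing.weight R′)             ∎))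
        , extracted-describes fin visited (digits 2<) (array= κ 0 _) (array= κ 1 _)))))
      where open ≤-Reasoning

-- Initialisation and running time

module Solution (I : Instance) where
  open Instance I

  ρ : ℕ → ℕ
  ρ = radix-1 I

  N M : ℕ
  N = capacity ρ (3 + n)
  M = N + (3 + n)

  open Timed M

  m≤M : 3 + n ≤ M
  m≤M = m≤n+m (3 + n) N

  pred-n : suc (pred n) ≡ n
  pred-n = suc-pred n
    where instance _ = >-nonZero (≤-trans z<s (toℕ<n (proj₁ depots-nonempty)))

  radix≤ : ∀ i → suc (ρ i) ≤ 3 + n
  radix≤ 0 = ≤-trans (≤-reflexive pred-n) (m≤n+m n 3)
  radix≤ 1 = ≤-trans (≤-reflexive pred-n) (m≤n+m n 3)
  radix≤ 2 = m≤n+m (suc n) 2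
  radix≤ (suc (suc (suc u))) = s≤s (≤-trans (characteristic-≤1 clients u) (s≤s z≤n))

  record Scanned (u x : ℕ) (B₃ B₄ B₅ : ℕ → ℕ) : Set where
    constructor scanned
    field
      x=    : x ≡ u * n
      depot : ∀ {j} → j < u → B₃ j ≡ fromList (characteristic depots) j
      radix : ∀ {j} → j < 3 + u → B₄ j ≡ suc (ρ j)
      row   : ∀ {j} → j < u → B₅ j ≡ j * n

  open Scanned

  run-prelude : Run prelude (initial I) (λ σ →
                  (regs σ rn ≡ n × regs σ rk ≡ k × regs σ rm ≡ 3 + n × arrays σ 2 ≡ fromList (matrix I)) ×
                  regs σ rN ≡ N × Scanned n (n * n) (arrays σ 3) (arrays σ 4) (arrays σ 5))
  run-prelude =
    run-⨾ (run-≔ (run-⨾ (run-store (run-⨾ (run-store (run-⨾ (run-store (run-⨾ (run-≔ (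
      run-for (λ u σ → Scanned u (regs σ rx) (arrays σ 3) (arrays σ 4) (arrays σ 5)) (≤-trans (m≤n+m n 3) m≤M) refl
        (scanned refl (λ ()) first-radices (λ ()))
        (λ {u} {σ} κ u<n u= S → run-⨾ (run-store (run-⨾ (run-store (run-⨾ (run-store (run-≔
          (scanned
            (cong₂ _+_ (reg= κ rn _) (x= S))
            (subst (λ u′ → ∀ {j} → j < suc u → (arrays σ 3 [ u′ ↦ arrays σ 0 u′ ]) j ≡ fromList (characteristic depots) j)
              (sym u=) (update-extends (depot S) (cong (λ A → A u) (array= κ 0 _))))
            (subst (λ u′ → ∀ {j} → j < 4 + u → (arrays σ 4 [ 3 + u′ ↦ 1 + arrays σ 1 u′ ]) j ≡ suc (ρ j))
              (sym u=) (update-extends (radix S) (cong (λ A → suc (A u)) (array= κ 1 _))))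
            (subst (λ u′ → ∀ {j} → j < suc u → (arrays σ 5 [ u′ ↦ regs σ rx ]) j ≡ j * n)
              (sym u=) (update-extends (row S) (x= S)))))))))))
      then λ {σ₁} κ₁ S → run-⨾ (run-≔ (weaken
        (run-for (λ i σ → regs σ rN ≡ capacity ρ i) m≤M (reg= κ₁ rm _) refl
          (λ {i} {σ} κ i<m i= N≡ → run-⨾ (run-≔ (run-⨾ (run-≔
            -- The product with the radix is formed by repeated addition; the radix is at most
            -- `3 + n`, hence at most `M`.
            (run-for (λ u σ′ → regs σ′ rx ≡ u * capacity ρ i) (≤-trans (radix≤ i) m≤M)
               (trans (cong₂ (λ A j → A j) (array= κ 4 _) i=) (radix S i<m)) refl
               (λ κ₂ _ _ x≡ → run-≔ (cong₂ _+_ (trans (reg= κ₂ rN _) N≡) x≡))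
            then λ _ x≡ → run-≔ (trans x≡ (sym (capacity-suc ρ i)))))))))
        λ κ₂ N≡ →
          ( trans (reg= κ₂ rn _) (reg= κ₁ rn _) , trans (reg= κ₂ rk _) (reg= κ₁ rk _)
          , trans (reg= κ₂ rm _) (reg= κ₁ rm _) , trans (array= κ₂ 2 _) (array= κ₁ 2 _))
          , N≡
          , scanned refl
              (λ j<n → trans (cong (λ A → A _) (array= κ₂ 3 _)) (depot S j<n))
              (λ j<m → trans (cong (λ A → A _) (array= κ₂ 4 _)) (radix S j<m))
              (λ j<n → trans (cong (λ A → A _) (array= κ₂ 5 _)) (row S j<n))))))))))))))
    where
    first-radices : ∀ {j} → j < 3 → _ ≡ suc (ρ j)
    first-radices {0} _ = sym pred-n
    first-radices {1} _ = sym pred-n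
    first-radices {2} _ = refl
    first-radices {suc (suc (suc _))} (s≤s (s≤s (s≤s ())))

  run-program : Run program (initial I) (IsAnswer I)
  run-program = run-prelude then λ {σ} _ ((n≡ , k≡ , m≡ , A₂≡) , N≡ , S) →
    -- The arrays left by the prelude are themselves the parameters, since their values are
    -- specified only on the scanned positions.
    let open Tracing I M (arrays σ 3) (arrays σ 4) (arrays σ 5) m≤M (m≤m+n N (3 + n)) (depot S) (radix S) (row S)
        open Search I M (arrays σ 3) (arrays σ 4) (arrays σ 5) m≤M (m≤m+n N (3 + n)) (depot S) (radix S) (row S)
          using (run-tables; still; Ready)
        ready : Ready σ
        ready = inputs n≡ k≡ N≡ m≡ A₂≡ refl refl refl
    in run-tables ready then λ κ (off≡ , F) → run-output (still ready κ) off≡ F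

-- From rounds to the time bound

size depth : Cmd → ℕ
size skip            = 1
size (x ≔ e)         = suc (cost e)
size (store a e₁ e₂) = suc (cost e₁ + cost e₂)
size (c ⨾ d)         = size c + size d
size (cond e c d)    = suc (cost e) + (size c + size d)
size (while e c)     = suc (cost e) + (suc (cost e) + size c)
depth skip          = 0
depth (x ≔ e)       = 0
depth (store _ _ _) = 0
depth (c ⨾ d)       = depth c ⊔ depth d
depth (cond _ c d)  = depth c ⊔ depth d
depth (while _ c)   = suc (depth c)

-- Each level of loop nesting costs one more factor `suc M`; using `suc M` rather than `M` keeps the
-- powers positive and monotone. Size and depth are constants of the program, so the bound is
-- polynomial in `M`.
bound≤ : ∀ M c → bound M c ≤ size c * suc M ^ depth c
bound≤ M c = go c
  where
  B = suc M
  open ≤-Reasoning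
  1≤ : ∀ d → 1 ≤ B ^ d
  1≤ = m^n>0 B
  n≤n* : ∀ m d → m ≤ m * B ^ d
  n≤n* m d = ≤-trans (≤-reflexive (sym (*-identityʳ m))) (*-monoʳ-≤ m (1≤ d))
  both : ∀ c d → bound M c ≤ size c * B ^ depth c → bound M d ≤ size d * B ^ depth d →
         bound M c + bound M d ≤ (size c + size d) * B ^ (depth c ⊔ depth d)
  both c d p q = ≤-trans
    (+-mono-≤ (≤-trans p (*-monoʳ-≤ (size c) (^-monoʳ-≤ B (m≤m⊔n (depth c) (depth d)))))
              (≤-trans q (*-monoʳ-≤ (size d) (^-monoʳ-≤ B (m≤n⊔m (depth c) (depth d))))))
    (≤-reflexive (sym (*-distribʳ-+ _ (size c) (size d))))
  go : ∀ c → bound M c ≤ size c * B ^ depth c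
  go skip            = ≤-refl
  go (x ≔ e)         = n≤n* (suc (cost e)) 0
  go (store a e₁ e₂) = n≤n* (suc (cost e₁ + cost e₂)) 0
  go (c ⨾ d)         = both c d (go c) (go d)
  go (cond e c d)    = ≤-trans (+-mono-≤ (n≤n* (suc (cost e)) (depth c ⊔ depth d)) (both c d (go c) (go d)))
                         (≤-reflexive (sym (*-distribʳ-+ (B ^ (depth c ⊔ depth d)) (suc (cost e)) (size c + size d))))
  go (while e c)     = begin
    s + M * (s + bound M c)                           ≤⟨ +-monoʳ-≤ s (*-mono-≤ (n≤1+n M)
                                                           (+-mono-≤ (n≤n* s (depth c)) (go c))) ⟩
    s + B * (s * B ^ depth c + size c * B ^ depth c)  ≤⟨ +-monoˡ-≤ _ (n≤n* s (suc (depth c))) ⟩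
    s * (B * B ^ depth c) + B * (s * B ^ depth c + size c * B ^ depth c)
                                                      ≡⟨ regroup s (size c) B (B ^ depth c) ⟩
    (s + (s + size c)) * (B * B ^ depth c)            ∎
    where
    s = suc (cost e)
    regroup : ∀ s z B X → s * (B * X) + B * (s * X + z * X) ≡ (s + (s + z)) * (B * X)
    regroup = solve-∀

capacity-characteristic : ∀ {n} (p : Subset n) → capacity (fromList (characteristic p)) n ≡ 2 ^ ∣ p ∣
capacity-characteristic []          = refl
capacity-characteristic (true ∷ p)  = cong (2 *_) (capacity-characteristic p)
capacity-characteristic (false ∷ p) = trans (*-identityˡ _) (capacity-characteristic p)

-- The factor 2 is there for `c = 1`; from 2 on the bases can be compared.
2^c≤2*c^c : ∀ c → 2 ^ c ≤ 2 * c ^ c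
2^c≤2*c^c 0 = s≤s z≤n
2^c≤2*c^c 1 = ≤-refl
2^c≤2*c^c c@(suc (suc _)) = ≤-trans (^-monoˡ-≤ c (s≤s (s≤s z≤n))) (m≤n*m (c ^ c) 2)

^-distribʳ-* : ∀ m n o → (m * n) ^ o ≡ m ^ o * n ^ o
^-distribʳ-* m n zero    = refl
^-distribʳ-* m n (suc o) = trans (cong (m * n *_) (^-distribʳ-* m n o)) (regroup m n (m ^ o) (n ^ o))
  where
  regroup : ∀ m n x y → m * n * (x * y) ≡ m * x * (n * y)
  regroup = solve-∀

module _ (I : Instance) where
  open Instance I
  open Solution I

  private
    c = ∣ clients ∣

    N≡ : N ≡ n * (n * (suc n * 2 ^ c))
    N≡ = cong₂ _*_ pred-n (cong₂ _*_ pred-n (cong (suc n *_) (capacity-characteristic clients)))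

  -- A depot exists, so `n ≥ 1`, which gives `suc n ≤ 2 * n` and `4 + n ≤ 5 * n`. The coefficients 2
  -- and 5 add up to 7, and replacing `2 ^ c` by `2 * c ^ c` doubles this.
  M-bound : suc M ≤ 14 * (c ^ c * n ^ 3)
  M-bound = begin
    suc (N + (3 + n))                              ≡⟨ +-suc N (3 + n) ⟨
    N + (4 + n)                                    ≡⟨ cong (_+ (4 + n)) N≡ ⟩
    n * (n * (suc n * 2 ^ c)) + (4 + n)            ≤⟨ +-mono-≤ first second ⟩
    2 * (2 ^ c * n ^ 3) + 5 * (2 ^ c * n ^ 3)      ≡⟨ *-distribʳ-+ (2 ^ c * n ^ 3) 2 5 ⟨
    7 * (2 ^ c * n ^ 3)                            ≤⟨ *-monoʳ-≤ 7 (*-monoˡ-≤ (n ^ 3) (2^c≤2*c^c c)) ⟩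
    7 * (2 * c ^ c * n ^ 3)                        ≡⟨ double (c ^ c) (n ^ 3) ⟩
    14 * (c ^ c * n ^ 3)                           ∎
    where
    open ≤-Reasoning
    instance
      n≢0 : NonZero n
      n≢0 = subst NonZero pred-n _
    double : ∀ x y → 7 * (2 * x * y) ≡ 14 * (x * y)
    double = solve-∀
    regroup₁ : ∀ x n → n * (n * ((n + n) * x)) ≡ 2 * (x * (n * (n * (n * 1))))
    regroup₁ = solve-∀
    n≥1 : 1 ≤ n
    n≥1 = >-nonZero⁻¹ n
    first : n * (n * (suc n * 2 ^ c)) ≤ 2 * (2 ^ c * n ^ 3)
    first = ≤-trans (*-monoʳ-≤ n (*-monoʳ-≤ n (*-monoˡ-≤ (2 ^ c) (+-monoˡ-≤ n n≥1)))) (≤-reflexive (regroup₁ (2 ^ c) n))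
    n≤ : n ≤ 2 ^ c * n ^ 3
    n≤ = ≤-trans (m≤m*n n (n ^ 2) {{m^n≢0 n 2}}) (m≤n*m (n ^ 3) (2 ^ c) {{m^n≢0 2 c}})
    second : 4 + n ≤ 5 * (2 ^ c * n ^ 3)
    second = ≤-trans (+-monoˡ-≤ n (*-monoʳ-≤ 4 n≥1)) (≤-trans (≤-reflexive (+-comm (4 * n) n)) (*-monoʳ-≤ 5 n≤))

module _ (I : Instance) where
  open Instance I
  open Solution I using (M)

  time-bound : ∀ z D → z * suc M ^ D ≤ z * 14 ^ D * ∣ clients ∣ ^ (D * ∣ clients ∣) * n ^ (3 * D)
  time-bound z D = begin
    z * suc M ^ D                              ≤⟨ *-monoʳ-≤ z (^-monoˡ-≤ D (M-bound I)) ⟩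
    z * (14 * (c ^ c * n ^ 3)) ^ D             ≡⟨ cong (z *_) (^-distribʳ-* 14 (c ^ c * n ^ 3) D) ⟩
    z * (14 ^ D * (c ^ c * n ^ 3) ^ D)         ≡⟨ cong (λ x → z * (14 ^ D * x)) (^-distribʳ-* (c ^ c) (n ^ 3) D) ⟩
    z * (14 ^ D * ((c ^ c) ^ D * (n ^ 3) ^ D)) ≡⟨ cong₂ (λ x y → z * (14 ^ D * (x * y)))
                                                    (trans (^-*-assoc c c D) (cong (c ^_) (*-comm c D))) (^-*-assoc n 3 D) ⟩
    z * (14 ^ D * (c ^ (D * c) * n ^ (3 * D))) ≡⟨ *-assoc z (14 ^ D) _ ⟨
    z * 14 ^ D * (c ^ (D * c) * n ^ (3 * D))   ≡⟨ *-assoc (z * 14 ^ D) _ _ ⟨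
    z * 14 ^ D * c ^ (D * c) * n ^ (3 * D)     ∎
    where
    open ≤-Reasoning
    c = ∣ clients ∣

-- Stated for an arbitrary command, so that `size P` and `depth P` stay symbolic in the arithmetic.
solves-within : ∀ P → (∀ I → Timed.Run (Solution.M I) P (initial I) (IsAnswer I)) →
                SolvesVRPWithin P (λ I → let open Instance I in
                  size P * 14 ^ depth P * ∣ clients ∣ ^ (depth P * ∣ clients ∣) * n ^ (3 * depth P))
solves-within P runs I =
  let open Timed.Run (runs I) in
  final , steps , executes ,
  ≤-trans in-time (≤-trans (bound≤ (Solution.M I) P) (time-bound I (size P) (depth P))) , post

theorem3p2 : Σ[ P ∈ Cmd ] Σ[ a ∈ ℕ ] Σ[ b ∈ ℕ ] Σ[ d ∈ ℕ ]
    SolvesVRPWithin P (λ I → let open Instance I in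
    a * ∣ clients ∣ ^ (b * ∣ clients ∣) * n ^ d)
theorem3p2 = program , size program * 14 ^ depth program , depth program , 3 * depth program ,
  solves-within program Solution.run-program
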